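{- Let $G$ be a complete multipartite graph with independence number $m\geq 2$. Suppose there are a partition $\Pi=\{\underline{X}_{m-1},\underline{X}_{m-2},\ldots,\underline{X}_{1},\overline{X}_{2},\ldots,\overline{X}_{m}\}$ of the parts of $G$ (of the kind described in the context) and a function $f:V(G)\rightarrow\mathbb{N}$ such that, with $F,S,\alpha,\beta$ and $\ell_j$ as defined in the context from $(\Pi,f)$: (R1) $F(j)\geq \alpha(j)+\beta(j)$ for all $j=1,\ldots,m$; and (R2) $\displaystyle f(v)\geq S(m-j)+\sum_{p=1}^{j-1}|V(\underline{X}_p)|+\sum_{q=1}^{i-1}|V(\underline{X}_{j,q})|+1$ for all $v\in V(\underline{X}_{j,i})$, for all $j=1,\ldots,m-1$ and $1\leq i\leq \ell_j$. Then $G$ is on-line $f$-choosable.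
   Context: All graphs are finite and simple. The parts of a complete multipartite graph are its partite sets (maximal independent sets); the independence number is the largest size of a part. On-line $f$-list coloring game. Given a graph $G$ and an integer-valued function $f$ on $V(G)$, two players Alice and Bob play as follows. Initially all vertices are uncolored. In round $i$, Alice marks a nonempty subset $V_i$ of the remaining uncolored vertices (assigning color $i$ as a permissible color to each vertex of $V_i$); then Bob chooses an independent set $X_i\subseteq V_i$ and colors all vertices of $X_i$ with color $i$. If at the end of some round there is a vertex $v$ that has been marked $f(v)$ times but is not yet colored, Alice wins. Otherwise Bob wins, i.e. in the end each vertex $v$ is colored by Bob before running out of $f(v)$ permissible colors. $G$ is on-line $f$-choosable if Bob has a winning strategy. Partition $\Pi$. The set of parts of $G$ is partitioned into families $\underline{X}_{m-1},\ldots,\underline{X}_{1},\overline{X}_{2},\ldots,\overline{X}_{m}$ (some possibly empty), where for $2\leq p\leq m$ every part in $\overline{X}_p$ has size exactly $p$, and for $1\leq p\leq m-1$ every part in $\underline{X}_p$ has size at most $p$. Put $u_p=|\overline{X}_p|$ and $\ell_p=|\underline{X}_p|$ (numbers of parts). Each family $\underline{X}_p$ is ordered: $\underline{X}_p=(\underline{X}_{p,1},\ldots,\underline{X}_{p,\ell_p})$, where $\underline{X}_{p,i}$ is the $i$th part. $V(\cdot)$ denotes the set of vertices in a part or in a family of parts. For $y=1,\ldots,m$, $$F(y)=\min\Big\{\sum_{v\in Y}f(v): Y\subseteq X\text{ for some part } X\in\bigcup_{p=2}^m\overline{X}_p,\ |Y|=y\Big\},$$ with the convention that the minimum over the empty set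 is $+\infty$. For $j=1,\ldots,m$, $$S(j)=\sum_{p=2}^{j}u_p+\sum_{p=\max(j+1,2)}^m(p-j)u_p.$$ $\alpha(1)=\sum_{p=2}^m u_p$, $\beta(1)=0$, and for $j=2,\ldots,m$, $$\alpha(j)=\alpha(j-1)+S(j-1),\qquad \beta(j)=\beta(j-1)+\sum_{p=1}^{m-j+1}|V(\underline{X}_p)|.$$ Empty sums are $0$. -}

module Defs where

open import Data.Fin using (Fin)
import Data.Fin as Fin
open import Data.Fin.Subset using (Subset; _∈_; _⊆_; _─_; ⊤; ⋃; ∣_∣; Nonempty; inside; outside)
open import Data.Fin.Subset.Properties using (_∈?_; _⊆?_)
open import Data.List using (List; []; _∷_; _++_; map; filter; length; concatMap; applyUpTo; allFin)
import Data.List.Extrema as Extrema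
open import Data.List.Relation.Binary.Permutation.Propositional using (_↭_)
open import Data.List.Relation.Unary.All using (All)
open import Data.List.Relation.Unary.Any using (any?)
open import Data.Nat using (ℕ; zero; suc; _+_; _*_; _∸_; _≤_; _<_; _≟_)
import Data.Nat as ℕ
open import Data.Nat.ListAction using (sum)
open import Data.Nat.Properties using (≤-isTotalOrder)
open import Data.Product using (∃; _×_)
open import Data.Vec using ([]; _∷_; tabulate)
open import Function using (_∘_; _⇔_; Surjective)
open import Level using (0ℓ)
open import Relation.Binary using (Rel; Decidable; Symmetric; Irreflexive; TotalOrder)
open import Relation.Binary.Construct.Add.Supremum.NonStrict (_≤_) using (_≤⁺_; ≤⁺-isTotalOrder-≡) public
open import Relation.Binary.PropositionalEquality using (_≡_; _≢_)
open import Relation.Nullary using (¬_)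
open import Relation.Nullary.Construct.Add.Supremum using (_⁺; ⊤⁺; [_]) public
open import Relation.Nullary.Decidable using (does; _×-dec_)

record Graph (n : ℕ) : Set₁ where
  field
    Adj    : Rel (Fin n) 0ℓ
    adj?   : Decidable Adj
    sym    : Symmetric Adj
    irrefl : Irreflexive _≡_ Adj

Independent : ∀ {n} → Graph n → Subset n → Set
Independent G X = ∀ {u v} → u ∈ X → v ∈ X → ¬ Graph.Adj G u v

IndependenceNumber : ∀ {n} → Graph n → ℕ → Set
IndependenceNumber G m =
  (∃ λ X → Independent G X × ∣ X ∣ ≡ m) × (∀ X → Independent G X → ∣ X ∣ ≤ m)

-- Surjectivity of partOf says that the parts are nonempty.
record CompleteMultipartite {n} (G : Graph n) : Set where
  field
    #parts     : ℕ
    partOf     : Fin n → Fin #parts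
    surjective : Surjective _≡_ _≡_ partOf
    adjacent   : ∀ u v → Graph.Adj G u v ⇔ partOf u ≢ partOf v

  Part : Set
  Part = Fin #parts

  vertices : Part → Subset n
  vertices X = tabulate λ v → does (partOf v Fin.≟ X)

  V : List Part → Subset n
  V = ⋃ ∘ map vertices

module _ {n : ℕ} where

  -- The sets marked by Alice so far, the most recent one first.
  History : Set
  History = List (Subset n)

  -- A strategy for Bob. At a nonempty history it gives the set coloured in
  -- reply to the head of the history; its value at [] is never used.
  Strategy : Set
  Strategy = History → Subset n

  uncoloured : Strategy → History → Subset n
  uncoloured σ []      = ⊤
  uncoloured σ (A ∷ h) = uncoloured σ h ─ σ (A ∷ h)

  timesMarked : Fin n → History → ℕ
  timesMarked v h = length (filter (v ∈?_) h)

  -- The histories that can arise when Bob follows σ.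
  data Play (σ : Strategy) : History → Set where
    start : Play σ []
    round : ∀ {h A} → Play σ h → Nonempty A → A ⊆ uncoloured σ h → Play σ (A ∷ h)

  -- Every round adds a mark, so the last clause bounds the length of plays
  -- by the sum of f; Alice can move as long as some vertex is uncoloured,
  -- hence a play that cannot be continued has all vertices coloured.
  Winning : Graph n → (Fin n → ℕ) → Strategy → Set
  Winning G f σ = ∀ {h A} → Play σ (A ∷ h) →
    σ (A ∷ h) ⊆ A ×
    Independent G (σ (A ∷ h)) ×
    (∀ {v} → v ∈ uncoloured σ (A ∷ h) → timesMarked v (A ∷ h) < f v)

OnlineChoosable : ∀ {n} → Graph n → (Fin n → ℕ) → Set
OnlineChoosable G f = ∃ (Winning G f)

-- The list a, a+1, …, b, which is empty when b < a.
[_⋯_] : ℕ → ℕ → List ℕ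
[ a ⋯ b ] = applyUpTo (a +_) (suc b ∸ a)

∑[_⋯_] : ℕ → ℕ → (ℕ → ℕ) → ℕ
∑[ a ⋯ b ] g = sum (map g [ a ⋯ b ])

∑∈ : ∀ {n} → Subset n → (Fin n → ℕ) → ℕ
∑∈ {n} Y f = sum (map f (filter (_∈? Y) (allFin n)))

subsets : ∀ n → List (Subset n)
subsets zero    = [] ∷ []
subsets (suc n) = map (outside ∷_) (subsets n) ++ map (inside ∷_) (subsets n)

-- ℕ ⁺ is ℕ with the top element ⊤⁺ adjoined, playing the role of +∞.
≤⁺-totalOrder : TotalOrder 0ℓ 0ℓ 0ℓ
≤⁺-totalOrder = record { isTotalOrder = ≤⁺-isTotalOrder-≡ ≤-isTotalOrder }

minimum : List ℕ → ℕ ⁺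
minimum ns = Extrema.min ≤⁺-totalOrder ⊤⁺ (map [_] ns)

module _ {n} {G : Graph n} (M : CompleteMultipartite G) (m : ℕ) where
  open CompleteMultipartite M

  -- lower p is meant for 1 ≤ p ≤ m − 1 and upper p for 2 ≤ p ≤ m; values
  -- outside these ranges are ignored. The order of lower p is significant,
  -- that of upper p is not.
  record Partition : Set where
    field
      lower      : ℕ → List Part
      upper      : ℕ → List Part
      partition  : concatMap lower [ 1 ⋯ m ∸ 1 ] ++ concatMap upper [ 2 ⋯ m ] ↭ allFin #parts
      lower-size : ∀ p → 1 ≤ p → p ≤ m ∸ 1 → All (λ X → ∣ vertices X ∣ ≤ p) (lower p)
      upper-size : ∀ p → 2 ≤ p → p ≤ m → All (λ X → ∣ vertices X ∣ ≡ p) (upper p)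

module _ {n} {G : Graph n} {M : CompleteMultipartite G} {m : ℕ} (Π : Partition M m) where
  open CompleteMultipartite M
  open Partition Π

  u ℓ : ℕ → ℕ
  u p = length (upper p)
  ℓ p = length (lower p)

  F : (Fin n → ℕ) → ℕ → ℕ ⁺
  F f y = minimum (map (λ Y → ∑∈ Y f) (filter candidate? (subsets n)))
    where
    candidate? = λ Y →
      any? (λ X → Y ⊆? vertices X) (concatMap upper [ 2 ⋯ m ]) ×-dec (∣ Y ∣ ≟ y)

  S : ℕ → ℕ
  S j = ∑[ 2 ⋯ j ] u + ∑[ (j + 1) ℕ.⊔ 2 ⋯ m ] (λ p → (p ∸ j) * u p)

  -- α and β are meant for 1 ≤ j ≤ m; the values at 0 are dummies.
  α : ℕ → ℕ
  α 0               = 0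
  α 1               = ∑[ 2 ⋯ m ] u
  α (suc j@(suc _)) = α j + S j

  β : ℕ → ℕ
  β 0               = 0
  β 1               = 0
  β (suc j@(suc _)) = β j + ∑[ 1 ⋯ m ∸ suc j + 1 ] (λ p → ∣ V (lower p) ∣)

{-# OPTIONS --safe #-}
-- Index the lower family p by the key m − p, so that it comes first when the key is large, and
-- put D(k) = S(k) + (number of vertices in lower parts with key ≥ k). The right-hand side of (R1)
-- is then demand(j − 1) = u + D(1) + … + D(j − 1), u the number of upper parts, and (R2) asks of a
-- vertex with key κ more than S(κ) plus the number of vertices in earlier lower parts. Bob keeps
-- both conditions true for the remaining colours and vertices. When Alice marks A, he colours
--  * an upper part X ⊆ A, if there is one;
--  * else X ∩ A, if some Y ⊆ X ∩ A with X upper attains its demand; take ∣Y∣ = y largest. The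
--    vertices of X outside A then have at least D(y) colours left and can be appended to the
--    lower parts of key y. Larger subsets do not attain their demand, which leaves them one
--    colour to spare where the demand falls too little;
--  * else Z ∩ A for the first marked lower part Z, if its key is at least the largest value t of
--    ∣X ∩ A∣ over upper parts X;
--  * else X ∩ A with ∣X ∩ A∣ = t. The rest of X stays upper, unless it is a single vertex, which
--    becomes the first lower part.
module Submission where

open import Defs
import Data.Nat.Properties
open import Algebra.Properties.CommutativeSemigroup Data.Nat.Properties.+-commutativeSemigroup
  using (interchange; x∙yz≈xz∙y; x∙yz≈y∙xz; x∙yz≈yx∙z; xy∙z≈xz∙y)
open import Data.Bool using (true; false; if_then_else_)
open import Data.Fin using (Fin; zero; suc; toℕ)
import Data.Fin as Fin
open import Data.Fin.Subset
open import Data.Fin.Subset.Properties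
open import Data.List
  using (List; []; _∷_; _++_; map; filter; tabulate; allFin; length; concatMap; applyUpTo;
    lookup; take)
open import Data.List.Extrema using (min≤v⁺)
open import Data.List.Extrema.Nat using (argmax; argmax-sel; f[xs]≤f[argmax]; f[⊥]≤f[argmax])
open import Data.List.Membership.Propositional using (lose; find) renaming (_∈_ to _∈ˡ_)
open import Data.List.Membership.Propositional.Properties
  using (∈-++⁺ˡ; ∈-++⁺ʳ; ∈-++⁻; ∈-map⁺; ∈-filter⁺; ∈-concatMap⁻; ∈-applyUpTo⁺; ∈-applyUpTo⁻;
    ∈-allFin; ∈-∃++)
open import Data.List.Properties
  using (map-tabulate; map-++; map-∘; length-map; length-++; applyUpTo-∷ʳ; filter-reject)
open import Data.List.Relation.Binary.Permutation.Propositional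
  using (_↭_; ↭-refl; ↭-sym; ↭-trans; prep; swap; ↭⇒↭ₛ)
import Data.List.Relation.Binary.Permutation.Propositional.Properties as ↭
open import Data.List.Relation.Binary.Permutation.Propositional.Properties
  using (map⁺; ↭-length; All-resp-↭; Any-resp-↭; ∈-resp-↭)
import Data.List.Relation.Binary.Permutation.Setoid.Properties as SetoidPermutation
open import Data.List.Relation.Unary.All as All using (All; []; _∷_)
import Data.List.Relation.Unary.All.Properties as All
open import Data.List.Relation.Unary.AllPairs using ([]; _∷_)
open import Data.List.Relation.Unary.Any as Any using (Any; here; there; any?)
import Data.List.Relation.Unary.Any.Properties as Any
open import Data.List.Relation.Unary.First as First using (First; [_]; _∷_)
open import Data.List.Relation.Unary.Unique.Propositional using (Unique)
open import Data.List.Relation.Unary.Unique.Propositional.Properties using (allFin⁺)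
open import Data.Nat
open import Data.Nat.ListAction using (sum)
open import Data.Nat.ListAction.Properties using (sum-++; sum-↭)
open import Data.Nat.Properties
open import Data.Nat.Tactic.RingSolver using (solve-∀)
open import Data.Product using (_×_; _,_; proj₁; proj₂; ∃; ∃₂)
open import Data.Sum as Sum using (_⊎_; inj₁; inj₂)
open import Data.Vec using ([]; _∷_; here; there)
open import Data.Vec.Properties using ([]=⇒lookup; lookup⇒[]=; lookup∘tabulate)
open import Function using (_∘_; id; Equivalence)
open import Relation.Binary.Construct.Add.Supremum.NonStrict (_≤_)
  using (≤⁺-trans; [≤]-injective; [_])
open import Relation.Binary.Definitions using (tri<; tri≈; tri>)
open import Relation.Binary.PropositionalEquality
open import Relation.Nullary using (¬_; yes; no; does; contradiction)
open import Relation.Nullary.Decidable using (_×-dec_; toSum; dec-true; dec-false)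
open import Relation.Unary using (Pred; Decidable)

-- Budgets of sets of vertices

-- Reduces a linear inequality to one equation for the ring solver; `c` absorbs slack.
linear : ∀ {a b x y} c → a ≤ b → x + b + c ≡ a + y → x ≤ y
linear {a} {b} {x} {y} c a≤b eq = +-cancelˡ-≤ b x y (begin
  b + x      ≡⟨ +-comm b x ⟩
  x + b      ≤⟨ m≤m+n (x + b) c ⟩
  x + b + c  ≡⟨ eq ⟩
  a + y      ≤⟨ +-monoˡ-≤ y a≤b ⟩
  b + y      ∎)
  where open ≤-Reasoning

module _ {n : ℕ} where

  sum-filter-suc : ∀ {b} (Y : Subset n) g (xs : List (Fin n)) →
    sum (map g (filter (_∈? (b ∷ Y)) (map suc xs))) ≡ sum (map (g ∘ suc) (filter (_∈? Y) xs))
  sum-filter-suc Y g []       = refl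
  sum-filter-suc Y g (x ∷ xs) with does (x ∈? Y)
  ... | true  = cong (g (suc x) +_) (sum-filter-suc Y g xs)
  ... | false = sum-filter-suc Y g xs

  -- `∑∈` filters `allFin`; this equation makes sums accessible to induction on the subset as a
  -- vector.
  ∑∈-∷ : ∀ b (Y : Subset n) g → ∑∈ (b ∷ Y) g ≡ (if b then g zero else 0) + ∑∈ Y (g ∘ suc)
  ∑∈-∷ b Y g = trans (split b) (cong ((if b then g zero else 0) +_) (trans
    (cong (λ xs → sum (map g (filter (_∈? (b ∷ Y)) xs))) (sym (map-tabulate id suc)))
    (sum-filter-suc Y g (allFin n))))
    where
    split : ∀ b → ∑∈ (b ∷ Y) g ≡
      (if b then g zero else 0) + sum (map g (filter (_∈? (b ∷ Y)) (tabulate suc)))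
    split true  = refl
    split false = refl

-- g and g′ are the numbers of permissible colours left before and after Alice marks A.
record Charge {n} (A : Subset n) (g g′ : Fin n → ℕ) : Set where
  field
    charged   : ∀ v → g v ≤ suc (g′ v)
    uncharged : ∀ {v} → v ∉ A → g v ≤ g′ v

charge-tail : ∀ {n b} {A : Subset n} {g g′} → Charge (b ∷ A) g g′ → Charge A (g ∘ suc) (g′ ∘ suc)
charge-tail c .Charge.charged v     = Charge.charged c (suc v)
charge-tail c .Charge.uncharged v∉A = Charge.uncharged c λ { (there v∈A) → v∉A v∈A }

-- Each marked vertex of Y costs at most one colour. Hence Y still meets a demand d after the round
-- if it had d + `∣ Y ∩ A ∣` before.
∑∈-charge : ∀ {n} {A : Subset n} {g g′} → Charge A g g′ → ∀ Y → ∑∈ Y g ≤ ∣ Y ∩ A ∣ + ∑∈ Y g′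
∑∈-charge {A = []} c [] = z≤n
∑∈-charge {A = b ∷ A} {g} {g′} c (s ∷ Y)
  rewrite ∑∈-∷ s Y g | ∑∈-∷ s Y g′
  with s | b | Charge.uncharged c {zero} | ∑∈-charge (charge-tail c) Y
... | false | _     | _  | ih = ih
... | true  | true  | _  | ih = ≤-trans (+-mono-≤ (Charge.charged c zero) ih)
  (≤-reflexive (cong suc (x∙yz≈y∙xz (g′ zero) ∣ Y ∩ A ∣ _)))
... | true  | false | le | ih = ≤-trans (+-mono-≤ (le λ ()) ih)
  (≤-reflexive (x∙yz≈y∙xz (g′ zero) ∣ Y ∩ A ∣ _))

∑∈-⊥ : ∀ n (g : Fin n → ℕ) → ∑∈ ⊥ g ≡ 0
∑∈-⊥ zero    g = refl
∑∈-⊥ (suc n) g = trans (∑∈-∷ false ⊥ g) (∑∈-⊥ n (g ∘ suc))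

∑∈-insert : ∀ {n} (w : Fin n) Y g → ∑∈ (⁅ w ⁆ ∪ Y) g ≤ g w + ∑∈ Y g
∑∈-insert zero (s ∷ Y) g
  rewrite ∪-identityˡ Y | ∑∈-∷ true Y g | ∑∈-∷ s Y g = +-monoʳ-≤ (g zero) (m≤n+m _ _)
∑∈-insert (suc w) (s ∷ Y) g rewrite ∑∈-∷ s (⁅ w ⁆ ∪ Y) g | ∑∈-∷ s Y g =
  ≤-trans (+-monoʳ-≤ h (∑∈-insert w Y (g ∘ suc))) (≤-reflexive (x∙yz≈y∙xz h (g (suc w)) _))
  where
  h = if s then g zero else 0

∑∈-⁅⁆ : ∀ {n} (v : Fin n) g → ∑∈ ⁅ v ⁆ g ≤ g v
∑∈-⁅⁆ {n} v g = begin
  ∑∈ ⁅ v ⁆ g          ≡⟨ cong (λ Y → ∑∈ Y g) (∪-identityʳ ⁅ v ⁆) ⟨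
  ∑∈ (⁅ v ⁆ ∪ ⊥) g    ≤⟨ ∑∈-insert v ⊥ g ⟩
  g v + ∑∈ ⊥ g        ≡⟨ cong (g v +_) (∑∈-⊥ n g) ⟩
  g v + 0             ≡⟨ +-identityʳ (g v) ⟩
  g v                 ∎
  where open ≤-Reasoning

∣insert∣ : ∀ {n} {w : Fin n} {Y} → w ∉ Y → ∣ ⁅ w ⁆ ∪ Y ∣ ≡ suc ∣ Y ∣
∣insert∣ {w = zero}  {true  ∷ Y} w∉Y = contradiction here w∉Y
∣insert∣ {w = zero}  {false ∷ Y} w∉Y = cong suc (cong ∣_∣ (∪-identityˡ Y))
∣insert∣ {w = suc w} {true  ∷ Y} w∉Y = cong suc (∣insert∣ (w∉Y ∘ there))
∣insert∣ {w = suc w} {false ∷ Y} w∉Y = ∣insert∣ (w∉Y ∘ there)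

∣∩∣+∣─∣ : ∀ {n} (X A : Subset n) → ∣ X ∩ A ∣ + ∣ X ─ A ∣ ≡ ∣ X ∣
∣∩∣+∣─∣ []          []          = refl
∣∩∣+∣─∣ (false ∷ X) (false ∷ A) = ∣∩∣+∣─∣ X A
∣∩∣+∣─∣ (false ∷ X) (true  ∷ A) = ∣∩∣+∣─∣ X A
∣∩∣+∣─∣ (true  ∷ X) (false ∷ A) = trans (+-suc _ _) (cong suc (∣∩∣+∣─∣ X A))
∣∩∣+∣─∣ (true  ∷ X) (true  ∷ A) = cong suc (∣∩∣+∣─∣ X A)

x∈p─q⇒x∉q : ∀ {n} {x : Fin n} (p q : Subset n) → x ∈ p ─ q → x ∉ q
x∈p─q⇒x∉q (_ ∷ p) (_ ∷ q) (there x∈) (there x∈q) = x∈p─q⇒x∉q p q x∈ x∈q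

⊈⇒∣∩∣<∣∣ : ∀ {n} (Y A : Subset n) → ¬ Y ⊆ A → ∣ Y ∩ A ∣ < ∣ Y ∣
⊈⇒∣∩∣<∣∣ []          []          ⊈ = contradiction (λ ()) ⊈
⊈⇒∣∩∣<∣∣ (false ∷ Y) (_     ∷ A) ⊈ = ⊈⇒∣∩∣<∣∣ Y A (⊈ ∘ out⊆)
⊈⇒∣∩∣<∣∣ (true  ∷ Y) (false ∷ A) ⊈ = s≤s (∣p∩q∣≤∣p∣ Y A)
⊈⇒∣∩∣<∣∣ (true  ∷ Y) (true  ∷ A) ⊈ = s≤s (⊈⇒∣∩∣<∣∣ Y A (⊈ ∘ s⊆s))

-- Levels of demand

-- For k ≥ 1 this is the coefficient of $u_p$ in S(k).
ω : ℕ → ℕ → ℕ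
ω p k = 1 ⊔ (p ∸ k)

1≤ω : ∀ p k → 1 ≤ ω p k
1≤ω p k = m≤m⊔n 1 (p ∸ k)

ω-mono : ∀ {p q} k → p ≤ q → ω p k ≤ ω q k
ω-mono k p≤q = ⊔-monoʳ-≤ 1 (∸-monoˡ-≤ k p≤q)

≤ω : ∀ {p} x k → x + k ≤ p → x ≤ ω p k
≤ω {p} x k x+k≤p = ≤-trans (m+n≤o⇒m≤o∸n x x+k≤p) (m≤n⊔m 1 (p ∸ k))

level : ℕ → (ℕ → ℕ) → ℕ → ℕ
level c E zero    = c
level c E (suc k) = level c E k + E (suc k)

module _ {c c′ : ℕ} {E E′ : ℕ → ℕ} where

  -- A saving of d made by level j is not lost later, because later increments do not grow.
  level-extend : ∀ {j k d} → (∀ i → E′ i ≤ E i) → j ≤ k →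
    level c′ E′ j + d ≤ level c E j → level c′ E′ k + d ≤ level c E k
  level-extend {d = d} E′≤E j≤k base = go (≤⇒≤′ j≤k)
    where
    go : ∀ {k} → _ ≤′ k → level c′ E′ k + d ≤ level c E k
    go ≤′-refl               = base
    go (≤′-step {n = k} j≤k) = begin
      level c′ E′ k + E′ (suc k) + d ≡⟨ xy∙z≈xz∙y (level c′ E′ k) (E′ (suc k)) d ⟩
      level c′ E′ k + d + E′ (suc k) ≤⟨ +-mono-≤ (go j≤k) (E′≤E (suc k)) ⟩
      level c E k + E (suc k)        ∎
      where open ≤-Reasoning

  -- Every level after j saves one more. A saving of k at level k pays for k marks in a set of k + 1
  -- vertices; with `d` = 1 it pays for all k + 1.
  level-drop : ∀ {j k} d → (∀ i → j < i → i ≤ k → E′ i < E i) → j ≤ k →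
    level c′ E′ j + (d + j) ≤ level c E j → level c′ E′ k + (d + k) ≤ level c E k
  level-drop {j} d E′<E j≤k base = go (≤⇒≤′ j≤k) E′<E
    where
    shift : ∀ l e d k → l + e + (d + suc k) ≡ l + (d + k) + suc e
    shift = solve-∀
    go : ∀ {k} → j ≤′ k → (∀ i → j < i → i ≤ k → E′ i < E i) →
      level c′ E′ k + (d + k) ≤ level c E k
    go ≤′-refl               E′<E = base
    go (≤′-step {n = k} j≤k) E′<E = begin
      level c′ E′ k + E′ (suc k) + (d + suc k)
        ≡⟨ shift (level c′ E′ k) (E′ (suc k)) d k ⟩
      level c′ E′ k + (d + k) + suc (E′ (suc k))
        ≤⟨ +-mono-≤ (go j≤k λ i j<i i≤k → E′<E i j<i (m≤n⇒m≤1+n i≤k))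
                    (E′<E (suc k) (s≤s (≤′⇒≤ j≤k)) ≤-refl) ⟩
      level c E k + E (suc k) ∎
      where open ≤-Reasoning

-- Lower parts in the order in which they are served

Lower : ℕ → Set
Lower n = List (ℕ × Subset n)

module _ {n : ℕ} where

  -- S(k) for k ≥ 1, summed part by part because the sizes change during the game.
  spread : List (Subset n) → ℕ → ℕ
  spread U k = sum (map (λ X → ω ∣ X ∣ k) U)

  -- At K every `ω` is 1. So a lower part of key K at the head of the list asks only for `length U`
  -- + 1 colours per vertex, which (R1) for single vertices can supply.
  spread-top : ∀ {K} U → All (λ X → ∣ X ∣ ≤ suc K) U → spread U K ≡ length U
  spread-top {K} []      []             = refl
  spread-top {K} (X ∷ U) (X≤ ∷ U≤) = cong₂ _+_
    (m≥n⇒m⊔n≡m (m≤n+o⇒m∸n≤o ∣ X ∣ K (≤-trans X≤ (≤-reflexive (+-comm 1 K)))))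
    (spread-top U U≤)

  gate : ℕ → ℕ × Subset n → ℕ
  gate k (κ , Z) = if does (k ≤? κ) then ∣ Z ∣ else 0

  gate-≤ : ∀ {k κ Z} → k ≤ κ → gate k (κ , Z) ≡ ∣ Z ∣
  gate-≤ {k} {κ} {Z} k≤κ = cong (if_then ∣ Z ∣ else 0) (dec-true (k ≤? κ) k≤κ)

  gate-> : ∀ {k κ Z} → κ < k → gate k (κ , Z) ≡ 0
  gate-> {k} {κ} {Z} κ<k = cong (if_then ∣ Z ∣ else 0) (dec-false (k ≤? κ) (<⇒≱ κ<k))

  gate≤∣∣ : ∀ k κ Z → gate k (κ , Z) ≤ ∣ Z ∣
  gate≤∣∣ k κ Z with does (k ≤? κ)
  ... | true  = ≤-refl
  ... | false = z≤n

  gate-mono : ∀ k κ {Z Z′} → ∣ Z ∣ ≤ ∣ Z′ ∣ → gate k (κ , Z) ≤ gate k (κ , Z′)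
  gate-mono k κ Z≤ with does (k ≤? κ)
  ... | true  = Z≤
  ... | false = z≤n

  -- The lower vertices counted in D(k); at the start they account for the increment of β from k to
  -- k + 1.
  weight : Lower n → ℕ → ℕ
  weight L k = sum (map (gate k) L)

  infixr 5 _∷_

  -- b bounds the keys of the list, and a counts the vertices of the lower parts before it.
  data Served (s : ℕ → ℕ) (g : Fin n → ℕ) : ℕ → ℕ → Lower n → Set where
    []  : ∀ {b a} → Served s g b a []
    _∷_ : ∀ {b a κ Z L} →
      κ ≤ b × (∀ {v} → v ∈ Z → s κ + a < g v) →
      Served s g κ (a + ∣ Z ∣) L → Served s g b a ((κ , Z) ∷ L)

  key≤ : ∀ {s g b a L κ Z} → Served s g b a L → (κ , Z) ∈ˡ L → κ ≤ b
  key≤ ((κ≤b , _) ∷ _)      (here refl) = κ≤b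
  key≤ ((κ≤b , _) ∷ served) (there e∈)  = ≤-trans (key≤ served e∈) κ≤b

  -- A marked vertex loses a colour, so its requirement must fall strictly; for an unmarked one it
  -- must not rise. Passing a part adds the same number to `a` and `a′`, so the comparison can be
  -- made at the head of the list.
  served-mono : ∀ {A s s′ g g′ b a a′ L} → Charge A g g′ →
    (∀ {κ Z v} → (κ , Z) ∈ˡ L → v ∈ Z →
      s′ κ + a′ < s κ + a ⊎ v ∉ A × s′ κ + a′ ≤ s κ + a) →
    Served s g b a L → Served s′ g′ b a′ L
  served-mono c cheap [] = []
  served-mono {s = s} {s′} {a = a} {a′} c cheap (_∷_ {κ = κ} {Z} (κ≤b , rich) served) =
    (κ≤b , λ v∈Z → pay (cheap (here refl) v∈Z) (rich v∈Z)) ∷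
    served-mono c (λ {κ} e∈ v∈ → shift κ (cheap (there e∈) v∈)) served
    where
    open Charge c
    pay : ∀ {v x y} → x < y ⊎ v ∉ _ × x ≤ y → y < _ → x < _
    pay {v} (inj₁ x<y)         y<g = s≤s⁻¹ (≤-trans (s≤s x<y) (≤-trans y<g (charged v)))
    pay     (inj₂ (v∉A , x≤y)) y<g = ≤-trans (s≤s x≤y) (≤-trans y<g (uncharged v∉A))
    shift : ∀ κ {P : Set} → s′ κ + a′ < s κ + a ⊎ P × s′ κ + a′ ≤ s κ + a →
      s′ κ + (a′ + ∣ Z ∣) < s κ + (a + ∣ Z ∣) ⊎ P × s′ κ + (a′ + ∣ Z ∣) ≤ s κ + (a + ∣ Z ∣)
    shift κ rewrite sym (+-assoc (s′ κ) a′ ∣ Z ∣) | sym (+-assoc (s κ) a ∣ Z ∣) = λ where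
      (inj₁ lt)       → inj₁ (+-monoˡ-≤ ∣ Z ∣ lt)
      (inj₂ (p , le)) → inj₂ (p , +-monoˡ-≤ ∣ Z ∣ le)

  -- In a served list keys do not increase, so the new part comes last among those of key at least
  -- y, behind exactly `weight L y` vertices.
  insert : ℕ → Subset n → Lower n → Lower n
  insert y W []            = (y , W) ∷ []
  insert y W ((κ , Z) ∷ L) with y ≤? κ
  ... | yes _ = (κ , Z) ∷ insert y W L
  ... | no  _ = (y , W) ∷ (κ , Z) ∷ L

  insert-↭ : ∀ y W L → insert y W L ↭ (y , W) ∷ L
  insert-↭ y W []            = ↭-refl
  insert-↭ y W ((κ , Z) ∷ L) with y ≤? κ
  ... | yes _ = ↭-trans (prep _ (insert-↭ y W L)) (swap _ _ ↭-refl)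
  ... | no  _ = ↭-refl

  weight-insert : ∀ y W L k → weight (insert y W L) k ≡ gate k (y , W) + weight L k
  weight-insert y W L k = sum-↭ (map⁺ (gate k) (insert-↭ y W L))

  module _ {A : Subset n} {s s′ : ℕ → ℕ} {g g′ : Fin n → ℕ} (c : Charge A g g′) where

    -- `fits` is the requirement of the new part itself. `early` pays for a mark in the parts before
    -- it. The parts behind it have key below y and now wait for `∣ W ∣` more vertices, which `late`
    -- covers together with a mark.
    served-insert : ∀ {y W b a} L → y ≤ b →
      (∀ {w} → w ∈ W → s′ y + (a + weight L y) < g′ w) →
      (∀ κ → s′ κ < s κ) → (∀ κ → κ < y → s′ κ + ∣ W ∣ < s κ) →
      Served s g b a L → Served s′ g′ b a (insert y W L)
    served-insert {y} {a = a} [] y≤b fits early late [] =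
      (y≤b , λ w∈W → subst (λ x → s′ y + x < _) (+-identityʳ a) (fits w∈W)) ∷ []
    served-insert {y} {W} {b} {a} ((κ , Z) ∷ L) y≤b fits early late ((κ≤b , rich) ∷ served)
      with y ≤? κ
    ... | yes y≤κ =
      (κ≤b , λ v∈Z → ≤-trans (+-monoˡ-≤ a (early κ))
        (s≤s⁻¹ (≤-trans (rich v∈Z) (Charge.charged c _)))) ∷
      served-insert L y≤κ
        (λ {w} w∈W → subst (λ x → s′ y + x < g′ w)
          (trans (cong (λ x → a + (x + weight L y)) (gate-≤ {Z = Z} y≤κ))
            (sym (+-assoc a ∣ Z ∣ (weight L y))))
          (fits w∈W))
        early late served
    ... | no y≰κ =
      (y≤b , λ w∈W → ≤-trans (s≤s (+-monoʳ-≤ (s′ y) (m≤m+n a _))) (fits w∈W)) ∷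
      served-mono c
        (λ {κ′} e∈ _ → inj₁ (later κ′ (≤-trans (s≤s (key≤ relaxed e∈)) (≰⇒> y≰κ))))
        ((<⇒≤ (≰⇒> y≰κ) , rich) ∷ served)
      where
      -- The bound `b` is tightened to κ, so that `key≤` puts every remaining key below y.
      relaxed : Served s g κ a ((κ , Z) ∷ L)
      relaxed = (≤-refl , rich) ∷ served
      later : ∀ κ′ → κ′ < y → s′ κ′ + (a + ∣ W ∣) < s κ′ + a
      later κ′ κ′<y = begin-strict
        s′ κ′ + (a + ∣ W ∣) ≡⟨ x∙yz≈xz∙y (s′ κ′) a ∣ W ∣ ⟩
        s′ κ′ + ∣ W ∣ + a   <⟨ +-monoˡ-< a (late κ′ κ′<y) ⟩
        s κ′ + a            ∎
        where
        open ≤-Reasoning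

  FirstMarked : Subset n → Lower n → Set
  FirstMarked A = First (λ e → Empty (proj₂ e ∩ A)) (λ e → Nonempty (proj₂ e ∩ A))

  module _ {A : Subset n} where

    firstKey : ∀ {L} → FirstMarked A L → ℕ
    firstKey {(κ , _) ∷ _} [ _ ]   = κ
    firstKey               (_ ∷ f) = firstKey f

    clipped : ∀ {L} → FirstMarked A L → Subset n
    clipped {(_ , Z) ∷ _} [ _ ]   = Z ∩ A
    clipped               (_ ∷ f) = clipped f

    clip : ∀ {L} → FirstMarked A L → Lower n
    clip {(κ , Z) ∷ L} [ _ ]   = (κ , Z ─ A) ∷ L
    clip {e ∷ L}       (_ ∷ f) = e ∷ clip f

    -- Parts before the first marked one contain no marked vertex, and keys do not increase after
    -- it.
    marked≤firstKey : ∀ {s g b a L κ Z v} → Served s g b a L → (f : FirstMarked A L) →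
      (κ , Z) ∈ˡ L → v ∈ Z → v ∈ A → κ ≤ firstKey f
    marked≤firstKey _            [ _ ]       (here refl) _   _   = ≤-refl
    marked≤firstKey (_ ∷ served) [ _ ]       (there e∈)  _   _   = key≤ served e∈
    marked≤firstKey _            (empty ∷ f) (here refl) v∈Z v∈A =
      contradiction (_ , x∈p∩q⁺ (v∈Z , v∈A)) empty
    marked≤firstKey (_ ∷ served) (_ ∷ f)     (there e∈)  v∈Z v∈A =
      marked≤firstKey served f e∈ v∈Z v∈A

    weight-clip-≤ : ∀ {L} (f : FirstMarked A L) k → weight (clip f) k ≤ weight L k
    weight-clip-≤ {(κ , Z) ∷ L} [ _ ]   k =
      +-monoˡ-≤ (weight L k) (gate-mono k κ {Z ─ A} {Z} (∣p─q∣≤∣p∣ Z A))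
    weight-clip-≤ {e ∷ L}       (_ ∷ f) k = +-monoʳ-≤ (gate k e) (weight-clip-≤ f k)

    weight-clip-< : ∀ {L} (f : FirstMarked A L) k → k ≤ firstKey f → weight (clip f) k < weight L k
    weight-clip-< {(κ , Z) ∷ L} [ ne ]  k k≤κ
      rewrite gate-≤ {Z = Z} k≤κ | gate-≤ {Z = Z ─ A} k≤κ =
      +-monoˡ-≤ (weight L k) (p∩q≢∅⇒∣p─q∣<∣p∣ Z A ne)
    weight-clip-< {e ∷ L}       (_ ∷ f) k k≤κ = +-monoʳ-< (gate k e) (weight-clip-< f k k≤κ)

    -- Neither the parts before the clipped one nor what is left of it contain a marked vertex.
    -- Later parts have fewer vertices in front of them, which pays for their marks.
    served-clip : ∀ {s g g′ b a L} → Charge A g g′ → (f : FirstMarked A L) →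
      Served s g b a L → Served s g′ b a (clip f)
    served-clip {s} {a = a} c ([_] {κ , Z} ne) ((κ≤b , rich) ∷ served) =
      (κ≤b , λ v∈ → ≤-trans (rich (p─q⊆p Z A v∈)) (Charge.uncharged c (x∈p─q⇒x∉q Z A v∈))) ∷
      served-mono c
        (λ {κ′} _ _ → inj₁ (+-monoʳ-< (s κ′) (+-monoʳ-< a (p∩q≢∅⇒∣p─q∣<∣p∣ Z A ne))))
        served
    served-clip c (empty ∷ f) ((κ≤b , rich) ∷ served) =
      (κ≤b , λ v∈Z → ≤-trans (rich v∈Z)
        (Charge.uncharged c λ v∈A → empty (_ , x∈p∩q⁺ (v∈Z , v∈A)))) ∷
      served-clip c f served

-- Bob's moves

demand : ∀ {n} → List (Subset n) → Lower n → ℕ → ℕ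
demand U L = level (length U) (λ k → spread U k + weight L k)

spread-↭ : ∀ {n} {U U′ : List (Subset n)} k → U ↭ U′ → spread U k ≡ spread U′ k
spread-↭ k U↭U′ = sum-↭ (map⁺ _ U↭U′)

demand-↭ : ∀ {n} {U U′ : List (Subset n)} L k → U ↭ U′ → demand U L k ≡ demand U′ L k
demand-↭ L zero    U↭U′ = ↭-length U↭U′
demand-↭ L (suc k) U↭U′ =
  cong₂ _+_ (demand-↭ L k U↭U′) (cong (_+ weight L (suc k)) (spread-↭ (suc k) U↭U′))

module Moves {n} (G : Graph n) (K : ℕ) where

  -- `rich` is (R1) for one part, with the demand at k for sets of k + 1 vertices. `small` keeps the
  -- keys of new lower parts at most K and makes every `ω` equal to 1 at K.
  record Fits (d : ℕ → ℕ) (g : Fin n → ℕ) (X : Subset n) : Set where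
    constructor fits
    field
      independent : Independent G X
      small       : ∣ X ∣ ≤ suc K
      rich        : ∀ {Y k} → Y ⊆ X → ∣ Y ∣ ≡ suc k → d k ≤ ∑∈ Y g

  open Fits

  record Position (U : List (Subset n)) (L : Lower n) (R : Subset n) (g : Fin n → ℕ) : Set where
    field
      upperFits        : All (Fits (demand U L) g) U
      lowerServed      : Served (spread U) g K 0 L
      lowerIndependent : All (Independent G ∘ proj₂) L
      covered          : ∀ {v} → v ∈ R → Any (v ∈_) U ⊎ Any ((v ∈_) ∘ proj₂) L

  open Position

  ⊆-independent : ∀ {X Y : Subset n} → Y ⊆ X → Independent G X → Independent G Y
  ⊆-independent Y⊆X ind u∈Y v∈Y = ind (Y⊆X u∈Y) (Y⊆X v∈Y)

  fits-mono : ∀ {A d d′ g g′ X X′} → Charge A g g′ → X′ ⊆ X →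
    (∀ {Y k} → Y ⊆ X′ → ∣ Y ∣ ≡ suc k → d′ k + ∣ Y ∩ A ∣ ≤ ∑∈ Y g) →
    Fits d g X → Fits d′ g′ X′
  fits-mono {A} {d′ = d′} c X′⊆X affordable f = fits
    (⊆-independent X′⊆X (independent f))
    (≤-trans (p⊆q⇒∣p∣≤∣q∣ X′⊆X) (small f))
    λ {Y} {k} Y⊆X′ ∣Y∣≡ → +-cancelˡ-≤ ∣ Y ∩ A ∣ _ _
      (≤-trans (≤-reflexive (+-comm ∣ Y ∩ A ∣ (d′ k)))
        (≤-trans (affordable Y⊆X′ ∣Y∣≡) (∑∈-charge c Y)))

  -- Allows the part that Bob colours to be moved to the head of the list. Nothing is marked here,
  -- so the charge is over `⊥`.
  position-resp-↭ : ∀ {U U′ L R g} → U ↭ U′ → Position U L R g → Position U′ L R g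
  position-resp-↭ {U} {U′} {L} {g = g} U↭U′ P = record
    { upperFits        = All-resp-↭ U↭U′ (All.map
        (λ f → fits (independent f) (small f) λ {_} {k} Y⊆X ∣Y∣≡ →
          ≤-trans (demand-≤ k) (rich f Y⊆X ∣Y∣≡))
        (upperFits P))
    ; lowerServed      = served-mono {A = ⊥}
        (record { charged = λ _ → n≤1+n _ ; uncharged = λ _ → ≤-refl })
        (λ {κ} _ _ → inj₂ (∉⊥ , +-monoˡ-≤ 0 (≤-reflexive (sym (spread-↭ κ U↭U′))))) (lowerServed P)
    ; lowerIndependent = lowerIndependent P
    ; covered          = Sum.map₁ (Any-resp-↭ U↭U′) ∘ covered P
    }
    where
    demand-≤ : ∀ k → demand U′ L k ≤ demand U L k
    demand-≤ k = ≤-reflexive (sym (demand-↭ L k U↭U′))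

  ∩-monoˡ-∣∣ : ∀ {X Y A : Subset n} → Y ⊆ X → ∣ Y ∩ A ∣ ≤ ∣ X ∩ A ∣
  ∩-monoˡ-∣∣ {Y = Y} {A} Y⊆X = p⊆q⇒∣p∣≤∣q∣ λ v∈ →
    let v∈Y , v∈A = x∈p∩q⁻ Y A v∈ in x∈p∩q⁺ (Y⊆X v∈Y , v∈A)

  clip-independent : ∀ {A : Subset n} {L} (f : FirstMarked A L) →
    All (Independent G ∘ proj₂) L → All (Independent G ∘ proj₂) (clip f)
  clip-independent {A} ([_] {κ , Z} _) (ind ∷ inds) = ⊆-independent (p─q⊆p Z A) ind ∷ inds
  clip-independent     (_ ∷ f)         (ind ∷ inds) = ind ∷ clip-independent f inds

  clipped-independent : ∀ {A : Subset n} {L} (f : FirstMarked A L) →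
    All (Independent G ∘ proj₂) L → Independent G (clipped f)
  clipped-independent {A} ([_] {κ , Z} _) (ind ∷ _)  = ⊆-independent (p∩q⊆p Z A) ind
  clipped-independent     (_ ∷ f)         (_ ∷ inds) = clipped-independent f inds

  clipped⊆ : ∀ {A : Subset n} {L} (f : FirstMarked A L) → clipped f ⊆ A
  clipped⊆ {A} ([_] {κ , Z} _) = p∩q⊆q Z A
  clipped⊆     (_ ∷ f)         = clipped⊆ f

  clip-covers : ∀ {v L} {A : Subset n} (f : FirstMarked A L) → v ∉ clipped f →
    Any ((v ∈_) ∘ proj₂) L → Any ((v ∈_) ∘ proj₂) (clip f)
  clip-covers [ _ ]   v∉ (here v∈Z)  =
    here (x∈p∧x∉q⇒x∈p─q v∈Z λ v∈A → v∉ (x∈p∩q⁺ (v∈Z , v∈A)))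
  clip-covers [ _ ]   v∉ (there v∈L) = there v∈L
  clip-covers (_ ∷ f) v∉ (here v∈Z)  = here v∈Z
  clip-covers (_ ∷ f) v∉ (there v∈L) = there (clip-covers f v∉ v∈L)

  uncovered : ∀ {v U} {X A : Subset n} → Any (v ∈_) (X ∷ U) → v ∉ X ∩ A → v ∈ X ─ A ⊎ Any (v ∈_) U
  uncovered (here v∈X)  v∉ = inj₁ (x∈p∧x∉q⇒x∈p─q v∈X λ v∈A → v∉ (x∈p∩q⁺ (v∈X , v∈A)))
  uncovered (there v∈U) _  = inj₂ v∈U

  module _ {A : Subset n} {g g′ : Fin n → ℕ} (c : Charge A g g′) where

    open Charge c

    -- Without a critical set this holds also for Y ⊆ A, although Y then loses ∣ Y ∣ = k + 1.
    Thrifty : (ℕ → ℕ) → ℕ → Subset n → Set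
    Thrifty d k Y = ∣ Y ∩ A ∣ + d k ≤ k + ∑∈ Y g

    -- The saving of k in the demand covers the k that `Thrifty` leaves open.
    thrifty⇒affordable : ∀ {d d′ : ℕ → ℕ} {k Y} → d′ k + k ≤ d k → Thrifty d k Y →
      d′ k + ∣ Y ∩ A ∣ ≤ ∑∈ Y g
    thrifty⇒affordable {d} {d′} {k} {Y} drop thrifty =
      linear 0 (+-mono-≤ drop thrifty) (rearrange (d′ k) ∣ Y ∩ A ∣ (d k) k (∑∈ Y g))
      where
      rearrange : ∀ d′ a d k b → d′ + a + (d + (k + b)) + 0 ≡ d′ + k + (a + d) + b
      rearrange = solve-∀

    -- Removing X saves 1 in `length` and at least 1 at every level, hence k + 1 at level k: enough
    -- for a fully marked set of k + 1 vertices. The fall of `spread` pays for marks in lower parts.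
    colour-whole : ∀ {X U L R} → Position (X ∷ U) L R g → X ⊆ A →
      Position U L (R ─ (X ∩ A)) g′
    colour-whole {X} {U} {L} P X⊆A = record
      { upperFits        = All.map (λ f → fits-mono c id
          (λ {Y} {k} Y⊆X ∣Y∣≡ → ≤-trans
            (+-monoʳ-≤ (demand U L k) (≤-trans (∣p∩q∣≤∣p∣ Y A) (≤-reflexive ∣Y∣≡)))
            (≤-trans (drop k) (rich f Y⊆X ∣Y∣≡))) f)
          (All.tail (upperFits P))
      ; lowerServed      = served-mono c
          (λ {κ} _ _ → inj₁ (+-monoˡ-≤ 0 (+-monoˡ-≤ (spread U κ) (1≤ω ∣ X ∣ κ))))
          (lowerServed P)
      ; lowerIndependent = lowerIndependent P
      ; covered          = λ v∈ → cover (covered P (p─q⊆p _ _ v∈)) (x∈p─q⇒x∉q _ _ v∈)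
      }
      where
      drop : ∀ k → demand U L k + suc k ≤ demand (X ∷ U) L k
      drop k = level-drop 1
        (λ i _ _ → +-monoˡ-≤ (weight L i) (+-monoˡ-≤ (spread U i) (1≤ω ∣ X ∣ i)))
        z≤n (≤-reflexive (+-comm (length U) 1))
      cover : ∀ {v} → Any (v ∈_) (X ∷ U) ⊎ Any ((v ∈_) ∘ proj₂) L → v ∉ X ∩ A →
        Any (v ∈_) U ⊎ Any ((v ∈_) ∘ proj₂) L
      cover (inj₂ v∈L) _  = inj₂ v∈L
      cover (inj₁ v∈U) v∉ with uncovered v∈U v∉
      ... | inj₁ v∈X─A = contradiction (X⊆A (p─q⊆p X A v∈X─A)) (x∈p─q⇒x∉q X A v∈X─A)
      ... | inj₂ v∈U   = inj₁ v∈U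

    -- The increment at i loses `ω ∣ X ∣ i` and, for i ≤ y, gains w. It falls strictly except
    -- perhaps at i = y, so at least j + 1 is saved at level j < y, but only j is guaranteed from y
    -- on. For the larger sets `thrifty` makes up the missing colour.
    colour-critical : ∀ {X U L R Y k} → Position (X ∷ U) L R g →
      ∣ X ∩ A ∣ < ∣ X ∣ → Y ⊆ X → Y ⊆ A → ∣ Y ∣ ≡ suc k → ∑∈ Y g ≤ demand (X ∷ U) L k →
      (∀ {X′ Y′ k′} → X′ ∈ˡ U → Y′ ⊆ X′ → ∣ Y′ ∣ ≡ suc k′ → k < k′ →
        Thrifty (demand (X ∷ U) L) k′ Y′) →
      Position U (insert (suc k) (X ─ A) L) (R ─ (X ∩ A)) g′
    colour-critical {X} {U} {L} {R} {Y} {k} P t<p Y⊆X Y⊆A ∣Y∣≡ critical thrifty = record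
      { upperFits        = All.tabulate λ X′∈U → let f = All.lookup (All.tail (upperFits P)) X′∈U in
          fits-mono c id (λ Y′⊆X′ ∣Y′∣≡ → affordable f X′∈U Y′⊆X′ ∣Y′∣≡) f
      ; lowerServed      = served-insert c L y≤K enough
          (λ κ → +-monoˡ-≤ (spread U κ) (1≤ω ∣ X ∣ κ))
          (λ κ κ<y → ≤-trans (≤-reflexive (trans (cong suc (+-comm (spread U κ) w)) refl))
            (+-monoˡ-≤ (spread U κ) (room κ<y)))
          (lowerServed P)
      ; lowerIndependent = All-resp-↭ (↭-sym (insert-↭ y (X ─ A) L))
          (⊆-independent (p─q⊆p X A) (independent fX) ∷ lowerIndependent P)
      ; covered          = λ v∈ → cover (covered P (p─q⊆p _ _ v∈)) (x∈p─q⇒x∉q _ _ v∈)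
      }
      where
      open ≤-Reasoning
      y t w : ℕ
      y = suc k
      t = ∣ X ∩ A ∣
      w = ∣ X ─ A ∣
      L′ : Lower n
      L′ = insert y (X ─ A) L
      fX : Fits (demand (X ∷ U) L) g X
      fX = All.head (upperFits P)
      y≤t : y ≤ t
      y≤t = subst (_≤ t) ∣Y∣≡ (p⊆q⇒∣p∣≤∣q∣ λ v∈Y → x∈p∩q⁺ (Y⊆X v∈Y , Y⊆A v∈Y))
      y≤K : y ≤ K
      y≤K = s≤s⁻¹ (≤-trans (s≤s y≤t) (≤-trans t<p (small fX)))
      w+t≡p : w + t ≡ ∣ X ∣
      w+t≡p = trans (+-comm w t) (∣∩∣+∣─∣ X A)
      -- Here w = `∣ X ∣` - t and i < y ≤ t. At i = y itself the spare unit is gone, as `room′`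
      -- shows.
      room : ∀ {i} → i < y → suc w ≤ ω ∣ X ∣ i
      room {i} i<y = ≤ω (suc w) i (begin
        suc w + i ≡⟨ +-suc w i ⟨
        w + suc i ≤⟨ +-monoʳ-≤ w (≤-trans i<y y≤t) ⟩
        w + t     ≡⟨ w+t≡p ⟩
        ∣ X ∣     ∎)
      room′ : w ≤ ω ∣ X ∣ y
      room′ = ≤ω w y (≤-trans (+-monoʳ-≤ w y≤t) (≤-reflexive w+t≡p))

      E E′ : ℕ → ℕ
      E i = spread (X ∷ U) i + weight L i
      E′ i = spread U i + weight L′ i
      E-step : ∀ i d → d + gate i (y , X ─ A) ≤ ω ∣ X ∣ i → d + E′ i ≤ E i
      E-step i d le = begin
        d + (spread U i + weight L′ i)
          ≡⟨ cong (λ x → d + (spread U i + x)) (weight-insert y (X ─ A) L i) ⟩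
        d + (spread U i + (gate i (y , X ─ A) + weight L i))
          ≡⟨ regroup d (spread U i) _ (weight L i) ⟩
        d + gate i (y , X ─ A) + spread U i + weight L i
          ≤⟨ +-monoˡ-≤ (weight L i) (+-monoˡ-≤ (spread U i) le) ⟩
        ω ∣ X ∣ i + spread U i + weight L i ∎
        where
        regroup : ∀ d a b c → d + (a + (b + c)) ≡ d + b + a + c
        regroup = solve-∀
      E-early : ∀ {i} → i < y → E′ i < E i
      E-early {i} i<y = E-step i 1 (≤-trans (s≤s (gate≤∣∣ i y (X ─ A))) (room i<y))
      E-late : ∀ {i} → y < i → E′ i < E i
      E-late {i} y<i = E-step i 1
        (≤-trans (≤-reflexive (cong suc (gate-> {k = i} {y} {X ─ A} y<i))) (1≤ω ∣ X ∣ i))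
      E≤ : ∀ i → E′ i ≤ E i
      E≤ i with <-cmp i y
      ... | tri< i<y _ _  = <⇒≤ (E-early i<y)
      ... | tri> _ _ y<i  = <⇒≤ (E-late y<i)
      ... | tri≈ _ refl _ = E-step i 0 (≤-trans (gate≤∣∣ i y (X ─ A)) room′)
      drop-early : ∀ {j} → j ≤ k → demand U L′ j + suc j ≤ demand (X ∷ U) L j
      drop-early j≤k = level-drop 1 (λ i _ i≤j → E-early (s≤s (≤-trans i≤j j≤k)))
        z≤n (≤-reflexive (+-comm (length U) 1))
      -- The saving k + 1 reached at level k equals y; it survives level y, and each later level
      -- adds one.
      drop-late : ∀ {j} → y ≤ j → demand U L′ j + j ≤ demand (X ∷ U) L j
      drop-late y≤j = level-drop 0 (λ i y<i _ → E-late y<i) y≤j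
        (level-extend E≤ (n≤1+n k) (drop-early ≤-refl))

      affordable : ∀ {X′ Y′ k′} → Fits (demand (X ∷ U) L) g X′ → X′ ∈ˡ U →
        Y′ ⊆ X′ → ∣ Y′ ∣ ≡ suc k′ → demand U L′ k′ + ∣ Y′ ∩ A ∣ ≤ ∑∈ Y′ g
      affordable {Y′ = Y′} {k′} f X′∈U Y′⊆X′ ∣Y′∣≡ with k′ ≤? k
      ... | yes k′≤k = begin
        demand U L′ k′ + ∣ Y′ ∩ A ∣ ≤⟨ +-monoʳ-≤ (demand U L′ k′) (∣p∩q∣≤∣p∣ Y′ A) ⟩
        demand U L′ k′ + ∣ Y′ ∣     ≡⟨ cong (demand U L′ k′ +_) ∣Y′∣≡ ⟩
        demand U L′ k′ + suc k′     ≤⟨ drop-early k′≤k ⟩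
        demand (X ∷ U) L k′         ≤⟨ rich f Y′⊆X′ ∣Y′∣≡ ⟩
        ∑∈ Y′ g                     ∎
      ... | no k′≰k = thrifty⇒affordable {demand (X ∷ U) L} {demand U L′}
        (drop-late (≰⇒> k′≰k)) (thrifty X′∈U Y′⊆X′ ∣Y′∣≡ (≰⇒> k′≰k))

      -- Y has no more than its demand at k, so x alone must supply the next increment D(y), and x
      -- is unmarked. The inequality is strict because X itself contributes at least 1 to D(y).
      enough : ∀ {x} → x ∈ X ─ A → spread U y + (0 + weight L y) < g′ x
      enough {x} x∈ = +-cancelˡ-≤ (demand (X ∷ U) L k) _ _ (begin
        demand (X ∷ U) L k + suc (spread U y + weight L y)
          ≤⟨ +-monoʳ-≤ (demand (X ∷ U) L k)
               (+-monoˡ-≤ (weight L y) (+-monoˡ-≤ (spread U y) (1≤ω ∣ X ∣ y))) ⟩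
        demand (X ∷ U) L y
          ≤⟨ rich fX {⁅ x ⁆ ∪ Y}
              (λ z∈ → Sum.[ (λ z∈x → subst (_∈ X) (sym (x∈⁅y⁆⇒x≡y x z∈x)) (p─q⊆p X A x∈)) , Y⊆X ]
                (x∈p∪q⁻ ⁅ x ⁆ Y z∈))
              (trans (∣insert∣ (x∉A ∘ Y⊆A)) (cong suc ∣Y∣≡)) ⟩
        ∑∈ (⁅ x ⁆ ∪ Y) g
          ≤⟨ ∑∈-insert x Y g ⟩
        g x + ∑∈ Y g
          ≤⟨ +-mono-≤ (uncharged x∉A) critical ⟩
        g′ x + demand (X ∷ U) L k
          ≡⟨ +-comm (g′ x) _ ⟩
        demand (X ∷ U) L k + g′ x ∎)
        where
        x∉A : x ∉ A
        x∉A = x∈p─q⇒x∉q X A x∈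

      cover : ∀ {v} → Any (v ∈_) (X ∷ U) ⊎ Any ((v ∈_) ∘ proj₂) L → v ∉ X ∩ A →
        Any (v ∈_) U ⊎ Any ((v ∈_) ∘ proj₂) L′
      cover (inj₂ v∈L) _  = inj₂ (Any-resp-↭ (↭-sym (insert-↭ y (X ─ A) L)) (there v∈L))
      cover (inj₁ v∈U) v∉ with uncovered v∈U v∉
      ... | inj₁ v∈X─A = inj₂ (Any-resp-↭ (↭-sym (insert-↭ y (X ─ A) L)) (here v∈X─A))
      ... | inj₂ v∈U   = inj₁ v∈U

    -- Clipping saves one at each level up to the key κ. For k ≤ κ this suffices for thrifty sets;
    -- beyond κ the saving stays at least κ, and `few` bounds the marks in an upper part by κ.
    colour-first : ∀ {U L R} → Position U L R g → (f : FirstMarked A L) →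
      (∀ {X} → X ∈ˡ U → ∣ X ∩ A ∣ ≤ firstKey f) →
      (∀ {X Y k} → X ∈ˡ U → Y ⊆ X → ∣ Y ∣ ≡ suc k → Thrifty (demand U L) k Y) →
      Position U (clip f) (R ─ clipped f) g′
    colour-first {U} {L} P f few thrifty = record
      { upperFits        = All.tabulate λ X∈U → let f = All.lookup (upperFits P) X∈U in
          fits-mono c id (λ Y⊆X ∣Y∣≡ → affordable f X∈U Y⊆X ∣Y∣≡) f
      ; lowerServed      = served-clip c f (lowerServed P)
      ; lowerIndependent = clip-independent f (lowerIndependent P)
      ; covered          = λ v∈ →
          Sum.map₂ (clip-covers f (x∈p─q⇒x∉q _ _ v∈)) (covered P (p─q⊆p _ _ v∈))
      }
      where
      κ : ℕ
      κ = firstKey f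
      drop : ∀ {k} → k ≤ κ → demand U (clip f) k + k ≤ demand U L k
      drop k≤κ = level-drop 0
        (λ i _ i≤k → +-monoʳ-< (spread U i) (weight-clip-< f i (≤-trans i≤k k≤κ)))
        z≤n (≤-reflexive (+-identityʳ (length U)))
      affordable : ∀ {X Y k} → Fits (demand U L) g X → X ∈ˡ U →
        Y ⊆ X → ∣ Y ∣ ≡ suc k → demand U (clip f) k + ∣ Y ∩ A ∣ ≤ ∑∈ Y g
      affordable {X} {Y} {k} fX X∈U Y⊆X ∣Y∣≡ with k ≤? κ
      ... | yes k≤κ = thrifty⇒affordable {demand U L} {demand U (clip f)}
        (drop k≤κ) (thrifty X∈U Y⊆X ∣Y∣≡)
      ... | no  k≰κ = begin
        demand U (clip f) k + ∣ Y ∩ A ∣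
          ≤⟨ +-monoʳ-≤ (demand U (clip f) k) (≤-trans (∩-monoˡ-∣∣ Y⊆X) (few X∈U)) ⟩
        demand U (clip f) k + κ
          ≤⟨ level-extend (λ i → +-monoʳ-≤ (spread U i) (weight-clip-≤ f i))
               (<⇒≤ (≰⇒> k≰κ)) (drop ≤-refl) ⟩
        demand U L k
          ≤⟨ rich fX Y⊆X ∣Y∣≡ ⟩
        ∑∈ Y g ∎
        where open ≤-Reasoning

    module _ {X U L R} (P : Position (X ∷ U) L R g) (t<p : ∣ X ∩ A ∣ < ∣ X ∣)
      (most : ∀ {X′} → X′ ∈ˡ U → ∣ X′ ∩ A ∣ ≤ ∣ X ∩ A ∣)
      (thrifty : ∀ {X′ Y} → X′ ∈ˡ U → Y ⊆ X′ → ∣ Y ∣ ≡ 1 → Thrifty (demand (X ∷ U) L) 0 Y)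
      (early : ∀ {κ Z v} → (κ , Z) ∈ˡ L → v ∈ Z → v ∈ A → κ < ∣ X ∩ A ∣)
      where

      private
        t w : ℕ
        t = ∣ X ∩ A ∣
        w = ∣ X ─ A ∣
        w+t≡p : w + t ≡ ∣ X ∣
        w+t≡p = trans (+-comm w t) (∣∩∣+∣─∣ X A)
        fX : Fits (demand (X ∷ U) L) g X
        fX = All.head (upperFits P)
        E : ℕ → ℕ
        E i = spread (X ∷ U) i + weight L i

        -- A saving of t at level 1 persists, and by `most` no set has more than t marked vertices.
        -- Only single vertices, whose demand is at level 0, rely on `thrifty`.
        partly : ∀ {c′ E′} → c′ ≤ suc (length U) → (∀ i → E′ i ≤ E i) →
          c′ + E′ 1 + t ≤ suc (length U) + E 1 → All (Fits (level c′ E′) g′) U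
        partly {c′} {E′} c′≤ E′≤E first = All.tabulate λ X′∈U →
          let f = All.lookup (All.tail (upperFits P)) X′∈U in
          fits-mono c id (λ {Y} {k} Y⊆X′ ∣Y∣≡ → affordable {k = k} f X′∈U Y⊆X′ ∣Y∣≡) f
          where
          affordable : ∀ {X′ Y k} → Fits (demand (X ∷ U) L) g X′ → X′ ∈ˡ U →
            Y ⊆ X′ → ∣ Y ∣ ≡ suc k → level c′ E′ k + ∣ Y ∩ A ∣ ≤ ∑∈ Y g
          affordable {k = zero} f X′∈U Y⊆X′ ∣Y∣≡ =
            thrifty⇒affordable {demand (X ∷ U) L} {level c′ E′} {0}
              (≤-trans (≤-reflexive (+-identityʳ c′)) c′≤) (thrifty X′∈U Y⊆X′ ∣Y∣≡)
          affordable {Y = Y} {k = suc k} f X′∈U Y⊆X′ ∣Y∣≡ = begin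
            level c′ E′ (suc k) + ∣ Y ∩ A ∣
              ≤⟨ +-monoʳ-≤ (level c′ E′ (suc k)) (≤-trans (∩-monoˡ-∣∣ Y⊆X′) (most X′∈U)) ⟩
            level c′ E′ (suc k) + t
              ≤⟨ level-extend {c = suc (length U)} {c′} {E} {E′} {1} {suc k} {t}
                   E′≤E (s≤s z≤n) first ⟩
            demand (X ∷ U) L (suc k)
              ≤⟨ rich f Y⊆X′ ∣Y∣≡ ⟩
            ∑∈ Y g ∎
            where open ≤-Reasoning

        remainder : ∀ {v} → v ∈ R ─ (X ∩ A) → v ∈ X ─ A ⊎ Any (v ∈_) U ⊎ Any ((v ∈_) ∘ proj₂) L
        remainder v∈ with covered P (p─q⊆p _ _ v∈)
        ... | inj₁ v∈U = Sum.map₂ inj₁ (uncovered v∈U (x∈p─q⇒x∉q _ _ v∈))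
        ... | inj₂ v∈L = inj₂ (inj₂ v∈L)

      -- Left in an upper part, a single vertex would still add ω 1 k = 1 to every
      -- spread, and the demand would not fall by the number of marks.
      colour-all-but-one : w ≤ 1 → Position U ((K , X ─ A) ∷ L) (R ─ (X ∩ A)) g′
      colour-all-but-one w≤1 = record
        { upperFits        = partly (n≤1+n _) E′≤E first
        ; lowerServed      = (≤-refl , enough) ∷ served-mono c afford (lowerServed P)
        ; lowerIndependent = ⊆-independent (p─q⊆p X A) (independent fX) ∷ lowerIndependent P
        ; covered          = λ v∈ → Sum.[ inj₂ ∘ here , Sum.map₂ there ] (remainder v∈)
        }
        where
        open ≤-Reasoning
        E′ : ℕ → ℕ
        E′ i = spread U i + weight ((K , X ─ A) ∷ L) i
        gate≤1 : ∀ i → gate i (K , X ─ A) ≤ 1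
        gate≤1 i = ≤-trans (gate≤∣∣ i K (X ─ A)) w≤1
        E′≤E : ∀ i → E′ i ≤ E i
        E′≤E i = begin
          spread U i + (gate i (K , X ─ A) + weight L i)
            ≡⟨ x∙yz≈yx∙z (spread U i) _ (weight L i) ⟩
          gate i (K , X ─ A) + spread U i + weight L i
            ≤⟨ +-monoˡ-≤ (weight L i) (+-monoˡ-≤ (spread U i) (≤-trans (gate≤1 i) (1≤ω ∣ X ∣ i))) ⟩
          E i ∎

        -- The unit saved in `length` pays for the new lower vertex; the loss of X from `spread` is
        -- at least `∣ X ∣` - 1 ≥ t.
        first : length U + E′ 1 + t ≤ suc (length U) + E 1
        first = begin
          length U + (spread U 1 + (gate 1 (K , X ─ A) + weight L 1)) + t
            ≤⟨ +-mono-≤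
                 (+-monoʳ-≤ (length U) (+-monoʳ-≤ (spread U 1) (+-monoˡ-≤ (weight L 1) (gate≤1 1))))
                 (≤ω {∣ X ∣} t 1 (≤-trans (≤-reflexive (+-comm t 1)) t<p)) ⟩
          length U + (spread U 1 + (1 + weight L 1)) + ω ∣ X ∣ 1
            ≡⟨ rearrange (length U) (spread U 1) (weight L 1) (ω ∣ X ∣ 1) ⟩
          suc (length U) + E 1 ∎
          where
          rearrange : ∀ c s l o → c + (s + (1 + l)) + o ≡ suc c + (o + s + l)
          rearrange = solve-∀
        enough : ∀ {x} → x ∈ X ─ A → spread U K + 0 < g′ x
        enough {x} x∈ = begin-strict
          spread U K + 0 ≡⟨ +-identityʳ _ ⟩
          spread U K     ≡⟨ spread-top U (All.map small (All.tail (upperFits P))) ⟩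
          length U       <⟨ rich fX {⁅ x ⁆} {0}
                              (λ z∈ → subst (_∈ X) (sym (x∈⁅y⁆⇒x≡y x z∈)) (p─q⊆p X A x∈))
                              (∣⁅x⁆∣≡1 x) ⟩
          ∑∈ ⁅ x ⁆ g     ≤⟨ ∑∈-⁅⁆ x g ⟩
          g x            ≤⟨ uncharged (x∈p─q⇒x∉q X A x∈) ⟩
          g′ x           ∎
        pay : ∀ κ d → suc d ≤ ω ∣ X ∣ κ → d + (spread U κ + (0 + w)) ≤ spread (X ∷ U) κ + 0
        pay κ d d<ω = begin
          d + (spread U κ + w)      ≤⟨ +-monoʳ-≤ d (+-monoʳ-≤ (spread U κ) w≤1) ⟩
          d + (spread U κ + 1)      ≡⟨ rearrange d (spread U κ) ⟩
          suc d + spread U κ + 0    ≤⟨ +-monoˡ-≤ 0 (+-monoˡ-≤ (spread U κ) d<ω) ⟩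
          spread (X ∷ U) κ + 0      ∎
          where
          rearrange : ∀ d s → d + (s + 1) ≡ suc d + s + 0
          rearrange = solve-∀
        -- For a marked vertex κ < t < `∣ X ∣`, so X contributed at least 2: one unit pays for the
        -- mark, one for the vertex placed in front.
        afford : ∀ {κ Z v} → (κ , Z) ∈ˡ L → v ∈ Z →
          spread U κ + (0 + w) < spread (X ∷ U) κ + 0 ⊎
          v ∉ A × spread U κ + (0 + w) ≤ spread (X ∷ U) κ + 0
        afford {κ} {v = v} e∈ v∈Z with v ∈? A
        ... | yes v∈A = inj₁ (pay κ 1 (≤ω 2 κ (≤-trans (s≤s (early e∈ v∈Z v∈A)) t<p)))
        ... | no  v∉A = inj₂ (v∉A , pay κ 0 (1≤ω ∣ X ∣ κ))

      -- For w ≥ 2 the coefficient of X at level 1 falls from `∣ X ∣` - 1 to w - 1, a saving of t.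
      -- The rest of X is unmarked, so for its subsets it suffices that the demand does not rise.
      colour-some : 2 ≤ w → Position ((X ─ A) ∷ U) L (R ─ (X ∩ A)) g′
      colour-some 2≤w = record
        { upperFits        = fits-mono c (p─q⊆p X A) unmarked fX ∷ partly ≤-refl E′≤E first
        ; lowerServed      = served-mono c afford (lowerServed P)
        ; lowerIndependent = lowerIndependent P
        ; covered          = λ v∈ → Sum.[ inj₁ ∘ here , Sum.map₁ there ] (remainder v∈)
        }
        where
        open ≤-Reasoning
        E′ : ℕ → ℕ
        E′ i = spread ((X ─ A) ∷ U) i + weight L i
        ω≤ω : ∀ i → ω w i ≤ ω ∣ X ∣ i
        ω≤ω i = ω-mono i (∣p─q∣≤∣p∣ X A)
        E′≤E : ∀ i → E′ i ≤ E i
        E′≤E i = +-monoˡ-≤ (weight L i) (+-monoˡ-≤ (spread U i) (ω≤ω i))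
        first : suc (length U) + E′ 1 + t ≤ suc (length U) + E 1
        first = begin
          suc (length U) + E′ 1 + t
            ≡⟨ rearrange (suc (length U)) (ω w 1) (spread U 1) (weight L 1) t ⟩
          suc (length U) + (ω w 1 + t + spread U 1 + weight L 1)
            ≤⟨ +-monoʳ-≤ (suc (length U))
                 (+-monoˡ-≤ (weight L 1) (+-monoˡ-≤ (spread U 1) (shrink 2≤w))) ⟩
          suc (length U) + E 1 ∎
          where
          rearrange : ∀ c o s l t → c + (o + s + l) + t ≡ c + (o + t + s + l)
          rearrange = solve-∀
          shrink : 2 ≤ w → ω w 1 + t ≤ ω ∣ X ∣ 1
          shrink 2≤w = begin
            ω w 1 + t     ≡⟨ cong (_+ t) (m≤n⇒m⊔n≡n (m+n≤o⇒m≤o∸n 1 2≤w)) ⟩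
            w ∸ 1 + t     ≤⟨ ≤ω (w ∸ 1 + t) 1 (≤-reflexive (trans (+-comm (w ∸ 1 + t) 1)
                               (trans (cong (_+ t) (m+[n∸m]≡n (<⇒≤ 2≤w))) w+t≡p))) ⟩
            ω ∣ X ∣ 1     ∎
        unmarked : ∀ {Y k} → Y ⊆ X ─ A → ∣ Y ∣ ≡ suc k →
          demand ((X ─ A) ∷ U) L k + ∣ Y ∩ A ∣ ≤ ∑∈ Y g
        unmarked {Y} {k} Y⊆ ∣Y∣≡ = begin
          demand ((X ─ A) ∷ U) L k + ∣ Y ∩ A ∣
            ≡⟨ cong (demand ((X ─ A) ∷ U) L k +_) (trans (cong ∣_∣ (Empty-unique none)) (∣⊥∣≡0 n)) ⟩
          demand ((X ─ A) ∷ U) L k + 0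
            ≤⟨ level-extend {c = suc (length U)} {suc (length U)} {E} {E′} {0} {k} {0}
                 E′≤E z≤n (≤-reflexive (+-identityʳ _)) ⟩
          demand (X ∷ U) L k
            ≤⟨ rich fX (⊆-trans Y⊆ (p─q⊆p X A)) ∣Y∣≡ ⟩
          ∑∈ Y g ∎
          where
          none : Empty (Y ∩ A)
          none (v , v∈) = let v∈Y , v∈A = x∈p∩q⁻ Y A v∈ in x∈p─q⇒x∉q X A (Y⊆ v∈Y) v∈A
        afford : ∀ {κ Z v} → (κ , Z) ∈ˡ L → v ∈ Z →
          spread ((X ─ A) ∷ U) κ + 0 < spread (X ∷ U) κ + 0 ⊎
          v ∉ A × spread ((X ─ A) ∷ U) κ + 0 ≤ spread (X ∷ U) κ + 0
        afford {κ} {v = v} e∈ v∈Z with v ∈? A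
        ... | no  v∉A = inj₂ (v∉A , +-monoˡ-≤ 0 (+-monoˡ-≤ (spread U κ) (ω≤ω κ)))
        -- As κ < t, the old coefficient is at least w + 1, while the new one is at most w.
        ... | yes v∈A = inj₁ (+-monoˡ-≤ 0 (+-monoˡ-≤ (spread U κ) (begin
          suc (ω w κ)  ≤⟨ s≤s (⊔-lub (<⇒≤ 2≤w) (m∸n≤m w κ)) ⟩
          suc w        ≤⟨ ≤ω (suc w) κ (begin
            suc w + κ    ≡⟨ +-suc w κ ⟨
            w + suc κ    ≤⟨ +-monoʳ-≤ w (early e∈ v∈Z v∈A) ⟩
            w + t        ≡⟨ w+t≡p ⟩
            ∣ X ∣        ∎) ⟩
          ω ∣ X ∣ κ    ∎)))

-- Bob's strategy

greatest : ∀ {ℓ} {P : Pred ℕ ℓ} → Decidable P → ∀ N →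
  (∃ λ k → P k × (∀ {k′} → k′ < N → k < k′ → ¬ P k′)) ⊎ (∀ {k} → k < N → ¬ P k)
greatest P? zero    = inj₂ λ ()
greatest {P = P} P? (suc N) with P? N
... | yes p = inj₁ (N , p , λ k′<sN N<k′ → contradiction N<k′ (≤⇒≯ (s≤s⁻¹ k′<sN)))
... | no ¬p with greatest P? N
...   | inj₁ (k , p , none) = inj₁ (k , p , λ k′<sN k<k′ → below (λ k′<N → none k′<N k<k′) k′<sN)
  where
  below : ∀ {k} → (k < N → ¬ P k) → k < suc N → ¬ P k
  below none k<sN = Sum.[ none , (λ { refl → ¬p }) ] (m≤n⇒m<n∨m≡n (s≤s⁻¹ k<sN))
...   | inj₂ none = inj₂ λ k<sN → Sum.[ none , (λ { refl → ¬p }) ] (m≤n⇒m<n∨m≡n (s≤s⁻¹ k<sN))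

heaviest : ∀ {a} {A : Set a} (h : A → ℕ) x xs →
  ∃ λ y → y ∈ˡ x ∷ xs × (∀ {z} → z ∈ˡ x ∷ xs → h z ≤ h y)
heaviest h x xs = argmax h x xs , Any.fromSum (argmax-sel h x xs) , λ where
  (here refl) → f[⊥]≤f[argmax] {f = h} x xs
  (there z∈)  → All.lookup (f[xs]≤f[argmax] {f = h} x xs) z∈

extract : ∀ {a} {A : Set a} {x : A} {xs} → x ∈ˡ xs → ∃ λ ys → xs ↭ x ∷ ys
extract x∈xs with ∈-∃++ x∈xs
... | ys , zs , refl = _ , ↭.shift _ ys zs

module Respond {n} (G : Graph n) (K : ℕ) where
  open Moves G K
  open Fits
  open Position

  Good : Subset n → (Fin n → ℕ) → Set
  Good R g = ∃₂ λ U L → Position U L R g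

  Reply : Subset n → Subset n → (Fin n → ℕ) → Set
  Reply A R g′ = ∃ λ T → T ⊆ A × Independent G T × Good (R ─ T) g′

  module _ {A R : Subset n} {g g′ : Fin n → ℕ} {U L}
    (c : Charge A g g′) (P : Position U L R g) where

    colour : ∀ {X U′ L′} → X ∈ˡ U → Position U′ L′ (R ─ (X ∩ A)) g′ → Reply A R g′
    colour {X} X∈U P′ = X ∩ A , p∩q⊆q X A ,
      ⊆-independent (p∩q⊆p X A) (independent (All.lookup (upperFits P) X∈U)) , _ , _ , P′

    Critical : ℕ → Subset n → Subset n → Set
    Critical k X Y = Y ⊆ X × Y ⊆ A × ∣ Y ∣ ≡ suc k × ∑∈ Y g ≤ demand U L k

    HasCritical : ℕ → Set
    HasCritical k = Any (λ X → ∃ (Critical k X)) U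

    hasCritical? : Decidable HasCritical
    hasCritical? k = any? (λ X → anySubset? λ Y →
      Y ⊆? X ×-dec Y ⊆? A ×-dec ∣ Y ∣ ≟ suc k ×-dec ∑∈ Y g ≤? demand U L k) U

    -- If Y ⊆ A, then Y exceeds its demand, as it is not critical; otherwise at most k of its k + 1
    -- vertices are marked.
    noncritical⇒thrifty : ∀ {X Y k} → X ∈ˡ U → Y ⊆ X → ∣ Y ∣ ≡ suc k →
      (k < n → ¬ HasCritical k) → Thrifty c (demand U L) k Y
    noncritical⇒thrifty {Y = Y} {k} X∈U Y⊆X ∣Y∣≡ none with Y ⊆? A
    ... | yes Y⊆A = begin
      ∣ Y ∩ A ∣ + demand U L k ≤⟨ +-monoˡ-≤ (demand U L k)
                                     (≤-trans (∣p∩q∣≤∣p∣ Y A) (≤-reflexive ∣Y∣≡)) ⟩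
      suc k + demand U L k     ≡⟨ +-suc k (demand U L k) ⟨
      k + suc (demand U L k)   ≤⟨ +-monoʳ-≤ k (≰⇒> λ Σ≤ →
                                     none k<n (lose X∈U (Y , Y⊆X , Y⊆A , ∣Y∣≡ , Σ≤))) ⟩
      k + ∑∈ Y g               ∎
      where
      open ≤-Reasoning
      k<n : k < n
      k<n = ≤-trans (≤-reflexive (sym ∣Y∣≡)) (∣p∣≤n Y)
    ... | no Y⊈A = +-mono-≤
      (s≤s⁻¹ (≤-trans (⊈⇒∣∩∣<∣∣ Y A Y⊈A) (≤-reflexive ∣Y∣≡)))
      (rich (All.lookup (upperFits P) X∈U) Y⊆X ∣Y∣≡)

    rest-thrifty : ∀ {X X′ U′ Y k} → U ↭ X ∷ U′ → X′ ∈ˡ U′ → Y ⊆ X′ → ∣ Y ∣ ≡ suc k →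
      (k < n → ¬ HasCritical k) → Thrifty c (demand (X ∷ U′) L) k Y
    rest-thrifty {Y = Y} {k} U↭ X′∈U′ Y⊆X′ ∣Y∣≡ none =
      subst (λ d → ∣ Y ∩ A ∣ + d ≤ k + ∑∈ Y g) (demand-↭ L k U↭)
        (noncritical⇒thrifty (∈-resp-↭ (↭-sym U↭) (there X′∈U′)) Y⊆X′ ∣Y∣≡ none)

    respond-critical : (∀ {X} → X ∈ˡ U → ¬ X ⊆ A) → ∀ {k} → HasCritical k →
      (∀ {k′} → k′ < n → k < k′ → ¬ HasCritical k′) → Reply A R g′
    respond-critical partly {k} critical none =
      let X , X∈U , Y , Y⊆X , Y⊆A , ∣Y∣≡ , Σ≤ = find critical
          U′ , U↭ = extract X∈U
      in colour X∈U (colour-critical c (position-resp-↭ U↭ P)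
        (⊈⇒∣∩∣<∣∣ X A (partly X∈U)) Y⊆X Y⊆A ∣Y∣≡
        (≤-trans Σ≤ (≤-reflexive (demand-↭ L k U↭)))
        λ X′∈U′ Y′⊆X′ ∣Y′∣≡ k<k′ →
          rest-thrifty U↭ X′∈U′ Y′⊆X′ ∣Y′∣≡ (λ k′<n → none k′<n k<k′))

    respond-early : ∀ {X} → X ∈ˡ U → ¬ X ⊆ A → (∀ {X′} → X′ ∈ˡ U → ∣ X′ ∩ A ∣ ≤ ∣ X ∩ A ∣) →
      (∀ {k} → k < n → ¬ HasCritical k) →
      (∀ {κ Z v} → (κ , Z) ∈ˡ L → v ∈ Z → v ∈ A → κ < ∣ X ∩ A ∣) → Reply A R g′
    respond-early {X} X∈U X⊈A most none early with extract X∈U | ∣ X ─ A ∣ ≤? 1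
    ... | U′ , U↭ | yes w≤1 = colour X∈U
      (colour-all-but-one c (position-resp-↭ U↭ P) (⊈⇒∣∩∣<∣∣ X A X⊈A)
        (most ∘ ∈-resp-↭ (↭-sym U↭) ∘ there)
        (λ X′∈ Y⊆X′ ∣Y∣≡ → rest-thrifty U↭ X′∈ Y⊆X′ ∣Y∣≡ none) early w≤1)
    ... | U′ , U↭ | no w≰1 = colour X∈U
      (colour-some c (position-resp-↭ U↭ P) (⊈⇒∣∩∣<∣∣ X A X⊈A)
        (most ∘ ∈-resp-↭ (↭-sym U↭) ∘ there)
        (λ X′∈ Y⊆X′ ∣Y∣≡ → rest-thrifty U↭ X′∈ Y⊆X′ ∣Y∣≡ none) early (≰⇒> w≰1))

    respond-first : (f : FirstMarked A L) → (∀ {X} → X ∈ˡ U → ∣ X ∩ A ∣ ≤ firstKey f) →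
      (∀ {k} → k < n → ¬ HasCritical k) → Reply A R g′
    respond-first f few none =
      clipped f , clipped⊆ f , clipped-independent f (lowerIndependent P) , _ , _ ,
      colour-first c P f few λ X∈U Y⊆X ∣Y∣≡ → noncritical⇒thrifty X∈U Y⊆X ∣Y∣≡ none

  Unmarked : Subset n → Lower n → Set
  Unmarked A = All (λ e → Empty (proj₂ e ∩ A))

  firstMarked? : ∀ A L → FirstMarked A L ⊎ Unmarked A L
  firstMarked? A = First.first (λ e → Sum.swap (toSum (nonempty? (proj₂ e ∩ A))))

  unmarked : ∀ {A Z : Subset n} {L κ v} → Unmarked A L → (κ , Z) ∈ˡ L → v ∈ Z → v ∉ A
  unmarked empty e∈ v∈Z v∈A = All.lookup empty e∈ (_ , x∈p∩q⁺ (v∈Z , v∈A))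

  module _ {A R : Subset n} {g g′ : Fin n → ℕ} (c : Charge A g g′) where

    colour-none : ∀ {L} → Position [] L R g → Unmarked A L → Position [] L (R ─ ⊥) g′
    colour-none P empty = record
      { upperFits        = []
      ; lowerServed      = served-mono c
          (λ e∈ v∈Z → inj₂ (unmarked empty e∈ v∈Z , ≤-refl)) (lowerServed P)
      ; lowerIndependent = lowerIndependent P
      ; covered          = λ v∈ → covered P (p─q⊆p R ⊥ v∈)
      }

    -- If no lower part is marked, or the first marked one has key below t, then all marked lower
    -- vertices have key below t, as `respond-early` requires.
    respond-noncritical : ∀ {U L} (P : Position U L R g) → (∀ {X} → X ∈ˡ U → ¬ X ⊆ A) →
      (∀ {k} → k < n → ¬ HasCritical c P k) → Reply A R g′
    respond-noncritical {[]} {L} P partly none with firstMarked? A L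
    ... | inj₁ f     = respond-first c P f (λ ()) none
    ... | inj₂ empty = ⊥ , ⊆-min A , (λ u∈⊥ → contradiction u∈⊥ ∉⊥) , _ , _ , colour-none P empty
    respond-noncritical {X₀ ∷ U} {L} P partly none
      with heaviest (λ X → ∣ X ∩ A ∣) X₀ U | firstMarked? A L
    ... | X , X∈ , most | inj₂ empty = respond-early c P X∈ (partly X∈) most none
      λ e∈ v∈Z v∈A → contradiction v∈A (unmarked empty e∈ v∈Z)
    ... | X , X∈ , most | inj₁ f with ∣ X ∩ A ∣ ≤? firstKey f
    ...   | yes t≤κ = respond-first c P f (λ X′∈ → ≤-trans (most X′∈) t≤κ) none
    ...   | no  t≰κ = respond-early c P X∈ (partly X∈) most none
      λ e∈ v∈Z v∈A → ≤-trans (s≤s (marked≤firstKey (lowerServed P) f e∈ v∈Z v∈A)) (≰⇒> t≰κ)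

    respond : Good R g → Reply A R g′
    respond (U , L , P) with any? (_⊆? A) U
    ... | yes some = let X , X∈U , X⊆A = find some ; U′ , U↭ = extract X∈U in
      colour c P X∈U (colour-whole c (position-resp-↭ U↭ P) X⊆A)
    -- A critical set has k + 1 ≤ n vertices, so searching below n finds a largest one.
    ... | no partly with greatest (hasCritical? c P) n
    ...   | inj₁ (_ , critical , none) =
      respond-critical c P (λ X∈U X⊆A → partly (lose X∈U X⊆A)) critical none
    ...   | inj₂ none                  =
      respond-noncritical P (λ X∈U X⊆A → partly (lose X∈U X⊆A)) none

  served-positive : ∀ {s : ℕ → ℕ} {g : Fin n → ℕ} {b a L v} → Served s g b a L →
    Any ((v ∈_) ∘ proj₂) L → 0 < g v
  served-positive ((_ , served) ∷ _) (here v∈Z)  = ≤-trans (s≤s z≤n) (served v∈Z)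
  served-positive (_ ∷ served)       (there v∈L) = served-positive served v∈L

  -- Bob has not lost: a vertex of an upper part has at least `length U` ≥ 1 colours by the demand
  -- at level 0, and the requirement on a lower vertex is a strict inequality.
  good-positive : ∀ {R g v} → Good R g → v ∈ R → 0 < g v
  good-positive {g = g} {v} (U , L , P) v∈R with covered P v∈R
  ... | inj₂ v∈L = served-positive (lowerServed P) v∈L
  ... | inj₁ v∈U = let X , X∈U , v∈X = find v∈U in begin
    1           ≤⟨ nonempty v∈U ⟩
    length U    ≤⟨ rich (All.lookup (upperFits P) X∈U) {⁅ v ⁆} {0}
                     (λ z∈ → subst (_∈ X) (sym (x∈⁅y⁆⇒x≡y v z∈)) v∈X) (∣⁅x⁆∣≡1 v) ⟩
    ∑∈ ⁅ v ⁆ g  ≤⟨ ∑∈-⁅⁆ v g ⟩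
    g v         ∎
    where
    open ≤-Reasoning
    nonempty : ∀ {a} {A : Set a} {P : A → Set} {xs} → Any P xs → 1 ≤ length xs
    nonempty (here _)  = s≤s z≤n
    nonempty (there _) = s≤s z≤n

  module Strategies (f : Fin n → ℕ) (good : Good ⊤ f) where

    budget : History → Fin n → ℕ
    budget h v = f v ∸ timesMarked v h

    budget-charge : ∀ A h → Charge A (budget h) (budget (A ∷ h))
    budget-charge A h .Charge.charged v with v ∈? A
    -- Subtraction is truncated; an exhausted budget stays 0, which `charged` allows.
    ... | yes _ =
      ≤-trans (n≤1+pred (f v ∸ timesMarked v h))
        (≤-reflexive (cong suc (pred[m∸n]≡m∸[1+n] (f v) (timesMarked v h))))
      where
      n≤1+pred : ∀ n → n ≤ suc (pred n)
      n≤1+pred zero    = z≤n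
      n≤1+pred (suc n) = ≤-refl
    ... | no  _ = n≤1+n _
    budget-charge A h .Charge.uncharged {v} v∉A =
      ≤-reflexive (cong (λ xs → f v ∸ length xs) (sym (filter-reject (v ∈?_) v∉A)))

    -- The invariant is carried along the history together with the replies: a situation determines
    -- the next reply, which contains the next situation.
    situation : ∀ h → ∃ λ R → Good R (budget h)
    reply : ∀ A h → Reply A (proj₁ (situation h)) (budget (A ∷ h))

    situation []      = ⊤ , good
    situation (A ∷ h) = let R , _ = situation h ; T , _ , _ , next = reply A h in R ─ T , next

    reply A h = respond (budget-charge A h) (proj₂ (situation h))

    strategy : Strategy
    strategy []      = ⊥
    strategy (A ∷ h) = proj₁ (reply A h)

    uncoloured-strategy : ∀ h → uncoloured strategy h ≡ proj₁ (situation h)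
    uncoloured-strategy []      = refl
    uncoloured-strategy (A ∷ h) = cong (_─ strategy (A ∷ h)) (uncoloured-strategy h)

    winning : Winning G f strategy
    winning {h} {A} _ = let T , T⊆A , independent , _ = reply A h in
      T⊆A , independent , λ {v} v∈ →
        m∸n≢0⇒n<m (≢-sym (<⇒≢ (good-positive (proj₂ (situation (A ∷ h)))
          (subst (v ∈_) (uncoloured-strategy (A ∷ h)) v∈))))

-- The initial position

-- The intervals `[_⋯_]` in a form whose start moves in the recursion, as splitting and the
-- induction over the families need.
upFrom : ℕ → ℕ → List ℕ
upFrom a zero    = []
upFrom a (suc d) = a ∷ upFrom (suc a) d

applyUpTo≡upFrom : ∀ {f : ℕ → ℕ} a → (∀ i → f i ≡ a + i) → ∀ d → applyUpTo f d ≡ upFrom a d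
applyUpTo≡upFrom a eq zero    = refl
applyUpTo≡upFrom a eq (suc d) = cong₂ _∷_ (trans (eq 0) (+-identityʳ a))
  (applyUpTo≡upFrom (suc a) (λ i → trans (eq (suc i)) (+-suc a i)) d)

range≡upFrom : ∀ a b → [ a ⋯ b ] ≡ upFrom a (suc b ∸ a)
range≡upFrom a b = applyUpTo≡upFrom a (λ _ → refl) (suc b ∸ a)

upFrom-++ : ∀ a d e → upFrom a (d + e) ≡ upFrom a d ++ upFrom (a + d) e
upFrom-++ a zero    e = cong (λ x → upFrom x e) (sym (+-identityʳ a))
upFrom-++ a (suc d) e = cong (a ∷_) (trans (upFrom-++ (suc a) d e)
  (cong (λ x → upFrom (suc a) d ++ upFrom x e) (sym (+-suc a d))))

range-++ : ∀ {a b c} → a ≤ suc c → c ≤ b → [ a ⋯ b ] ≡ [ a ⋯ c ] ++ [ suc c ⋯ b ]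
range-++ {a} {b} {c} a≤1+c c≤b = begin
  [ a ⋯ b ]                                   ≡⟨ range≡upFrom a b ⟩
  upFrom a (suc b ∸ a)                        ≡⟨ cong (upFrom a) lengths ⟩
  upFrom a (d + e)                            ≡⟨ upFrom-++ a d e ⟩
  upFrom a d ++ upFrom (a + d) e
    ≡⟨ cong (λ x → upFrom a d ++ upFrom x e) (m+[n∸m]≡n a≤1+c) ⟩
  upFrom a d ++ upFrom (suc c) e
    ≡⟨ cong₂ _++_ (range≡upFrom a c) (range≡upFrom (suc c) b) ⟨
  [ a ⋯ c ] ++ [ suc c ⋯ b ]                  ∎
  where
  open ≡-Reasoning
  d e : ℕ
  d = suc c ∸ a
  e = suc b ∸ suc c
  lengths : suc b ∸ a ≡ d + e
  lengths = begin
    suc b ∸ a                     ≡⟨ cong (_∸ a) (m+[n∸m]≡n (s≤s c≤b)) ⟨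
    suc c + (suc b ∸ suc c) ∸ a   ≡⟨ +-∸-comm (suc b ∸ suc c) a≤1+c ⟩
    d + e                         ∎

∈-range : ∀ {a b p} → p ∈ˡ [ a ⋯ b ] → a ≤ p × p ≤ b
∈-range {a} {b} p∈ with ∈-applyUpTo⁻ (a +_) p∈
... | i , i<d , refl = m≤m+n a i ,
  s≤s⁻¹ (≤-trans (≤-reflexive (cong suc (+-comm a i))) (m≤o∸n⇒m+n≤o (suc i) a≤1+b i<d))
  where
  a≤1+b : a ≤ suc b
  a≤1+b = <⇒≤ (m∸n≢0⇒n<m (≢-sym (<⇒≢ (≤-trans (s≤s z≤n) i<d))))

module _ {a} {A : Set a} where

  sum-mono : ∀ {h h′ : A → ℕ} xs → (∀ {x} → x ∈ˡ xs → h x ≤ h′ x) → sum (map h xs) ≤ sum (map h′ xs)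
  sum-mono []       h≤h′ = z≤n
  sum-mono (x ∷ xs) h≤h′ = +-mono-≤ (h≤h′ (here refl)) (sum-mono xs (h≤h′ ∘ there))

  sum-const : ∀ {h : A → ℕ} {c xs} → All (λ x → h x ≡ c) xs → sum (map h xs) ≡ c * length xs
  sum-const {c = c} []                 = sym (*-zeroʳ c)
  sum-const {c = c} (_∷_ {xs = xs} eq eqs) =
    trans (cong₂ _+_ eq (sum-const eqs)) (sym (*-suc c (length xs)))

  sum-map-++ : ∀ (h : A → ℕ) xs ys → sum (map h (xs ++ ys)) ≡ sum (map h xs) + sum (map h ys)
  sum-map-++ h xs ys = trans (cong sum (map-++ h xs ys)) (sum-++ (map h xs) (map h ys))

  sum-concatMap : ∀ {b} {B : Set b} (h : A → ℕ) (k : B → List A) ps →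
    sum (map h (concatMap k ps)) ≡ sum (map (λ p → sum (map h (k p))) ps)
  sum-concatMap h k []       = refl
  sum-concatMap h k (p ∷ ps) =
    trans (sum-map-++ h (k p) (concatMap k ps)) (cong (sum (map h (k p)) +_) (sum-concatMap h k ps))

  length-concatMap : ∀ {b} {B : Set b} (k : B → List A) ps →
    length (concatMap k ps) ≡ sum (map (length ∘ k) ps)
  length-concatMap k []       = refl
  length-concatMap k (p ∷ ps) =
    trans (length-++ (k p)) (cong (length (k p) +_) (length-concatMap k ps))

  unique-++⁻ : ∀ (xs : List A) {ys} → Unique (xs ++ ys) → Unique xs × Unique ys
  unique-++⁻ []       unique         = [] , unique
  unique-++⁻ (x ∷ xs) (x∉ ∷ unique) =
    let unique-xs , unique-ys = unique-++⁻ xs unique in All.++⁻ˡ xs x∉ ∷ unique-xs , unique-ys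

  unique-concatMap⁻ : ∀ {b} {B : Set b} {k : B → List A} {p ps} →
    Unique (concatMap k ps) → p ∈ˡ ps → Unique (k p)
  unique-concatMap⁻ unique (here refl) = proj₁ (unique-++⁻ _ unique)
  unique-concatMap⁻ unique (there p∈)  = unique-concatMap⁻ (proj₂ (unique-++⁻ _ unique)) p∈

∈-subsets : ∀ {n} (Y : Subset n) → Y ∈ˡ subsets n
∈-subsets []          = here refl
∈-subsets (false ∷ Y) = ∈-++⁺ˡ (∈-map⁺ (outside ∷_) (∈-subsets Y))
∈-subsets (true ∷ Y)  = ∈-++⁺ʳ _ (∈-map⁺ (inside ∷_) (∈-subsets Y))

∣∣+∣∣≤∣∪∣ : ∀ {n} {X Y : Subset n} → (∀ {v} → v ∈ X → v ∉ Y) → ∣ X ∣ + ∣ Y ∣ ≤ ∣ X ∪ Y ∣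
∣∣+∣∣≤∣∪∣ {X = X} {Y} disjoint = begin
  ∣ X ∣ + ∣ Y ∣ ≤⟨ +-mono-≤
    (p⊆q⇒∣p∣≤∣q∣ {p = X} λ v∈X → x∈p∩q⁺ (p⊆p∪q Y v∈X , v∈X))
    (p⊆q⇒∣p∣≤∣q∣ λ v∈Y → x∈p∧x∉q⇒x∈p─q (q⊆p∪q X Y v∈Y) λ v∈X → disjoint v∈X v∈Y) ⟩
  ∣ (X ∪ Y) ∩ X ∣ + ∣ (X ∪ Y) ─ X ∣ ≡⟨ ∣∩∣+∣─∣ (X ∪ Y) X ⟩
  ∣ X ∪ Y ∣ ∎
  where open ≤-Reasoning

module _ {n} {s : ℕ → ℕ} {g : Fin n → ℕ} where

  served-relax : ∀ {κ b a L} → κ ≤ b → Served s g κ a L → Served s g b a L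
  served-relax κ≤b []                       = []
  served-relax κ≤b ((κ′≤κ , rich) ∷ served) = (≤-trans κ′≤κ κ≤b , rich) ∷ served

  -- One family, all of the same key; the hypothesis on its i-th part is shaped like (R2).
  served-block : ∀ {A : Set} (h : A → Subset n) {κ b a L} xs → κ ≤ b →
    (∀ (i : Fin (length xs)) {v} → v ∈ h (lookup xs i) →
      s κ + (a + sum (map (λ x → ∣ h x ∣) (take (toℕ i) xs))) < g v) →
    Served s g κ (a + sum (map (λ x → ∣ h x ∣) xs)) L →
    Served s g b a (map (λ x → κ , h x) xs ++ L)
  served-block h {a = a} {L} [] κ≤b rich served =
    served-relax κ≤b (subst (λ a → Served s g _ a L) (+-identityʳ a) served)
  served-block h {κ} {a = a} {L} (x ∷ xs) κ≤b rich served =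
    (κ≤b , λ {v} v∈ → subst (λ a → s κ + a < g v) (+-identityʳ a) (rich zero v∈)) ∷
    served-block h xs ≤-refl
      (λ i {v} v∈ → subst (λ a → s κ + a < g v) (sym (+-assoc a ∣ h x ∣ _)) (rich (suc i) v∈))
      (subst (λ a → Served s g κ a L) (sym (+-assoc a ∣ h x ∣ _)) served)

-- Parts of a complete multipartite graph

module _ {n} {G : Graph n} (M : CompleteMultipartite G) where
  open CompleteMultipartite M

  ∈-vertices⁺ : ∀ {v X} → partOf v ≡ X → v ∈ vertices X
  ∈-vertices⁺ {v} {X} eq =
    lookup⇒[]= v _ (trans (lookup∘tabulate _ v) (dec-true (partOf v Fin.≟ X) eq))

  ∈-vertices⁻ : ∀ {v X} → v ∈ vertices X → partOf v ≡ X
  ∈-vertices⁻ {v} {X} v∈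
    with partOf v Fin.≟ X
       | trans (sym (lookup∘tabulate (λ v → does (partOf v Fin.≟ X)) v)) ([]=⇒lookup v∈)
  ... | yes eq | _  = eq
  ... | no  _  | ()

  vertices-independent : ∀ X → Independent G (vertices X)
  vertices-independent X {u} {v} u∈ v∈ adj =
    Equivalence.to (adjacent u v) adj (trans (∈-vertices⁻ u∈) (sym (∈-vertices⁻ v∈)))

  ∈-V⁻ : ∀ {v} Xs → v ∈ V Xs → partOf v ∈ˡ Xs
  ∈-V⁻ []       v∈ = contradiction v∈ ∉⊥
  ∈-V⁻ (X ∷ Xs) v∈ = Sum.[ here ∘ ∈-vertices⁻ , there ∘ ∈-V⁻ Xs ] (x∈p∪q⁻ (vertices X) (V Xs) v∈)

  size : List Part → ℕ
  size Xs = sum (map (λ X → ∣ vertices X ∣) Xs)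

  -- β and (R2) count whole families by the union `V`, positions by adding sizes. Distinct parts are
  -- disjoint, so the latter is no larger.
  size≤∣V∣ : ∀ {Xs} → Unique Xs → size Xs ≤ ∣ V Xs ∣
  size≤∣V∣ {[]}     _                = z≤n
  size≤∣V∣ {X ∷ Xs} (X∉ ∷ unique) = ≤-trans (+-monoʳ-≤ ∣ vertices X ∣ (size≤∣V∣ unique))
    (∣∣+∣∣≤∣∪∣ λ v∈X v∈V → All.lookup X∉ (∈-V⁻ Xs v∈V) (sym (∈-vertices⁻ v∈X)))

  module _ (m : ℕ) (1≤m : 1 ≤ m) (Π : Partition M m) (f : Fin n → ℕ) where
    open Partition Π

    private
      -- m - 1 bounds the keys m - p for p ≥ 1, and upper parts have at most m vertices.
      K : ℕ
      K = m ∸ 1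
      module Mv = Moves G K

    upperParts : List Part
    upperParts = concatMap upper [ 2 ⋯ m ]

    -- A lower part of the family p gets the key m − p.
    block : ℕ → Lower n
    block p = map (λ X → m ∸ p , vertices X) (lower p)

    U₀ : List (Subset n)
    U₀ = map vertices upperParts

    L₀ : Lower n
    L₀ = concatMap block [ 1 ⋯ m ∸ 1 ]

    ∈-upperParts⁻ : ∀ {X} → X ∈ˡ upperParts → ∣ vertices X ∣ ≤ m
    ∈-upperParts⁻ X∈ with find (∈-concatMap⁻ upper X∈)
    ... | p , p∈ , X∈p = let 2≤p , p≤m = ∈-range p∈ in
      ≤-trans (≤-reflexive (All.lookup (upper-size p 2≤p p≤m) X∈p)) p≤m

    -- A family is a segment of a list that permutes `allFin`.
    lower-unique : ∀ {p} → p ∈ˡ [ 1 ⋯ m ∸ 1 ] → Unique (lower p)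
    lower-unique = unique-concatMap⁻ (proj₁ (unique-++⁻ _
      (SetoidPermutation.Unique-resp-↭ (setoid Part) (↭⇒↭ₛ (↭-sym partition)) (allFin⁺ #parts))))

    spread≤S : ∀ {j} → 1 ≤ j → j ≤ m → spread U₀ j ≤ S Π j
    spread≤S {j@(suc i)} 1≤j j≤m = begin
      spread U₀ j
        ≡⟨ cong sum (map-∘ upperParts) ⟨
      sum (map (λ X → ω ∣ vertices X ∣ j) upperParts)
        ≡⟨ sum-concatMap _ upper [ 2 ⋯ m ] ⟩
      ∑[ 2 ⋯ m ] spreads
        ≡⟨ cong (sum ∘ map spreads) (range-++ {2} {m} {j} (s≤s 1≤j) j≤m) ⟩
      sum (map spreads ([ 2 ⋯ j ] ++ [ suc j ⋯ m ]))
        ≡⟨ sum-map-++ spreads [ 2 ⋯ j ] [ suc j ⋯ m ] ⟩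
      ∑[ 2 ⋯ j ] spreads + ∑[ suc j ⋯ m ] spreads
        ≤⟨ +-mono-≤ (sum-mono [ 2 ⋯ j ] λ {p} p∈ → let 2≤p , p≤j = ∈-range p∈ in
                       ≤-reflexive (trans (spreads≡ 2≤p (≤-trans p≤j j≤m))
                         (trans (cong (_* u Π p) (cong (1 ⊔_) (m≤n⇒m∸n≡0 p≤j)))
                           (*-identityˡ (u Π p)))))
                    (sum-mono [ suc j ⋯ m ] λ {p} p∈ → let j<p , p≤m = ∈-range p∈ in
                       ≤-reflexive (trans (spreads≡ (≤-trans (s≤s 1≤j) j<p) p≤m)
                         (cong (_* u Π p) (m≤n⇒m⊔n≡n (m<n⇒0<n∸m j<p))))) ⟩
      ∑[ 2 ⋯ j ] (u Π) + ∑[ suc j ⋯ m ] (λ p → (p ∸ j) * u Π p)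
        ≡⟨ cong (λ a → ∑[ 2 ⋯ j ] (u Π) + ∑[ a ⋯ m ] (λ p → (p ∸ j) * u Π p)) start≡ ⟨
      S Π j ∎
      where
      open ≤-Reasoning
      spreads : ℕ → ℕ
      spreads p = sum (map (λ X → ω ∣ vertices X ∣ j) (upper p))
      spreads≡ : ∀ {p} → 2 ≤ p → p ≤ m → spreads p ≡ ω p j * u Π p
      spreads≡ {p} 2≤p p≤m = sum-const (All.map (cong (λ x → ω x j)) (upper-size p 2≤p p≤m))
      start≡ : (j + 1) ⊔ 2 ≡ suc j
      start≡ = trans (cong (_⊔ 2) (+-comm j 1)) (m≥n⇒m⊔n≡m (s≤s 1≤j))

    size-lower≤ : ∀ {p} → p ∈ˡ [ 1 ⋯ m ∸ 1 ] → size (lower p) ≤ ∣ V (lower p) ∣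
    size-lower≤ = size≤∣V∣ ∘ lower-unique

    -- The key m - p is below j when p > m - j, so only the families up to m - j count.
    weight≤ : ∀ {j} → 1 ≤ j → j ≤ m → weight L₀ j ≤ ∑[ 1 ⋯ m ∸ j ] (λ p → ∣ V (lower p) ∣)
    weight≤ {j} 1≤j j≤m = begin
      weight L₀ j
        ≡⟨ sum-concatMap (gate j) block [ 1 ⋯ m ∸ 1 ] ⟩
      ∑[ 1 ⋯ m ∸ 1 ] gates
        ≡⟨ cong (sum ∘ map gates) split ⟩
      sum (map gates ([ 1 ⋯ m ∸ j ] ++ [ suc (m ∸ j) ⋯ m ∸ 1 ]))
        ≡⟨ sum-map-++ gates [ 1 ⋯ m ∸ j ] [ suc (m ∸ j) ⋯ m ∸ 1 ] ⟩
      ∑[ 1 ⋯ m ∸ j ] gates + ∑[ suc (m ∸ j) ⋯ m ∸ 1 ] gates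
        ≤⟨ +-mono-≤ (sum-mono [ 1 ⋯ m ∸ j ] λ {p} p∈ → ≤-trans (gates≤ p)
                      (size-lower≤ (subst (p ∈ˡ_) (sym split) (∈-++⁺ˡ p∈))))
                    (≤-reflexive (sum-const {c = 0} (All.tabulate {xs = [ suc (m ∸ j) ⋯ m ∸ 1 ]}
                      λ {p} p∈ → gates≡0 p (proj₁ (∈-range p∈))))) ⟩
      ∑[ 1 ⋯ m ∸ j ] (λ p → ∣ V (lower p) ∣) + 0
        ≡⟨ +-identityʳ _ ⟩
      ∑[ 1 ⋯ m ∸ j ] (λ p → ∣ V (lower p) ∣) ∎
      where
      open ≤-Reasoning
      gates : ℕ → ℕ
      gates p = sum (map (gate j) (block p))
      split : [ 1 ⋯ m ∸ 1 ] ≡ [ 1 ⋯ m ∸ j ] ++ [ suc (m ∸ j) ⋯ m ∸ 1 ]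
      split = range-++ (s≤s z≤n) (∸-monoʳ-≤ m 1≤j)
      gates-map : ∀ p → gates p ≡ sum (map (λ X → gate j (m ∸ p , vertices X)) (lower p))
      gates-map p = cong sum (sym (map-∘ (lower p)))
      gates≤ : ∀ p → gates p ≤ size (lower p)
      gates≤ p = ≤-trans (≤-reflexive (gates-map p))
        (sum-mono (lower p) λ {X} _ → gate≤∣∣ j (m ∸ p) (vertices X))
      gates≡0 : ∀ p → m ∸ j < p → gates p ≡ 0
      gates≡0 p m∸j<p = trans (gates-map p)
        (sum-const (All.universal (λ X → gate-> {Z = vertices X} late) (lower p)))
        where
        late : m ∸ p < j
        late = m<n+o⇒m∸n<o m p {{>-nonZero 1≤j}} (begin
            suc m                 ≤⟨ s≤s (m≤n+m∸n m j) ⟩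
            suc (j + (m ∸ j))     ≡⟨ +-suc j (m ∸ j) ⟨
            j + suc (m ∸ j)       ≤⟨ +-monoʳ-≤ j m∸j<p ⟩
            j + p                 ≡⟨ +-comm j p ⟩
            p + j                 ∎)

    -- Level k belongs to index k + 1 of α and β. The upper limit in the increment of β at index k +
    -- 2 is m - (k + 2) + 1, which is m - (k + 1) as in `weight≤`.
    demand≤ : ∀ k → k < m → demand U₀ L₀ k ≤ α Π (suc k) + β Π (suc k)
    demand≤ zero    _   = ≤-reflexive (begin
      length U₀                       ≡⟨ length-map vertices upperParts ⟩
      length upperParts               ≡⟨ length-concatMap upper [ 2 ⋯ m ] ⟩
      ∑[ 2 ⋯ m ] (u Π)                ≡⟨ +-identityʳ _ ⟨
      ∑[ 2 ⋯ m ] (u Π) + 0 ∎)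
      where open ≡-Reasoning
    demand≤ (suc k) k<m = begin
      demand U₀ L₀ k + (spread U₀ (suc k) + weight L₀ (suc k))
        ≤⟨ +-mono-≤ (demand≤ k (<⇒≤ k<m))
             (+-mono-≤ (spread≤S (s≤s z≤n) (<⇒≤ k<m)) (weight≤ (s≤s z≤n) (<⇒≤ k<m))) ⟩
      α Π (suc k) + β Π (suc k) + (S Π (suc k) + B (m ∸ suc k))
        ≡⟨ interchange (α Π (suc k)) (β Π (suc k)) (S Π (suc k)) _ ⟩
      α Π (suc k) + S Π (suc k) + (β Π (suc k) + B (m ∸ suc k))
        ≡⟨ cong (λ x → α Π (suc k) + S Π (suc k) + (β Π (suc k) + B x)) last≡ ⟩
      α Π (suc (suc k)) + β Π (suc (suc k)) ∎
      where
      open ≤-Reasoning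
      B : ℕ → ℕ
      B x = ∑[ 1 ⋯ x ] (λ p → ∣ V (lower p) ∣)
      last≡ : m ∸ suc k ≡ m ∸ suc (suc k) + 1
      last≡ = trans (+-∸-assoc 1 k<m) (+-comm 1 (m ∸ suc (suc k)))

    module _
      (R1 : ∀ j → 1 ≤ j → j ≤ m → [ α Π j + β Π j ] ≤⁺ F Π f j)
      (R2 : ∀ j → 1 ≤ j → j ≤ m ∸ 1 → (i : Fin (ℓ Π j)) → ∀ v → v ∈ vertices (lookup (lower j) i) →
        S Π (m ∸ j) + ∑[ 1 ⋯ j ∸ 1 ] (λ p → ∣ V (lower p) ∣)
          + sum (map (λ X → ∣ vertices X ∣) (take (toℕ i) (lower j))) + 1 ≤ f v)
      where

      -- Y is among the candidates whose minimum is F(k + 1), so (R1) bounds its sum.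
      rich₀ : ∀ {X} → X ∈ˡ upperParts → ∀ {Y k} → Y ⊆ vertices X → ∣ Y ∣ ≡ suc k →
        demand U₀ L₀ k ≤ ∑∈ Y f
      rich₀ {X} X∈ {Y} {k} Y⊆X ∣Y∣≡ = ≤-trans (demand≤ k k<m) ([≤]-injective
        (≤⁺-trans ≤-trans (R1 (suc k) (s≤s z≤n) k<m)
          (min≤v⁺ ≤⁺-totalOrder ⊤⁺ _ (inj₂ (lose
            (∈-map⁺ [_] (∈-map⁺ (λ Y → ∑∈ Y f)
              (∈-filter⁺ _ (∈-subsets Y) (Any.map (λ { refl {v} → Y⊆X {v} }) X∈ , ∣Y∣≡))))
            [ ≤-refl ])))))
        where
        k<m : k < m
        k<m = ≤-trans (≤-reflexive (sym ∣Y∣≡)) (≤-trans (p⊆q⇒∣p∣≤∣q∣ Y⊆X) (∈-upperParts⁻ X∈))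

      -- The d families from p + 1 to m - 1 follow in this order, so that keys decrease; `a` is at
      -- most the number of vertices that (R2) already counts for the families before them.
      served-from : ∀ d p {b a} → suc p + d ≡ m → m ∸ suc p ≤ b →
        a ≤ ∑[ 1 ⋯ p ] (λ p → ∣ V (lower p) ∣) →
        Served (spread U₀) f b a (concatMap block (upFrom (suc p) d))
      served-from zero    p _    _   _  = []
      served-from (suc d) p {a = a} p+d≡m κ≤b a≤ = served-block vertices (lower (suc p)) κ≤b
        (λ i {v} v∈ → begin
          suc (spread U₀ κ + (a + before i))
            ≤⟨ s≤s (+-mono-≤ (spread≤S (m<n⇒0<n∸m p<m) (m∸n≤m m (suc p)))
                 (+-monoˡ-≤ (before i) a≤)) ⟩
          suc (S Π κ + (B p + before i))
            ≡⟨ rearrange (S Π κ) (B p) (before i) ⟩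
          S Π κ + B p + before i + 1
            ≤⟨ R2 (suc p) (s≤s z≤n) p≤m-1 i v v∈ ⟩
          f v ∎)
        (served-from d (suc p) (trans (sym (+-suc (suc p) d)) p+d≡m)
          (∸-monoʳ-≤ m (n≤1+n (suc p))) (begin
          a + size (lower (suc p))
            ≤⟨ +-mono-≤ a≤ (size-lower≤ p∈) ⟩
          B p + ∣ V (lower (suc p)) ∣
            ≡⟨ cong (B p +_) (+-identityʳ _) ⟨
          B p + sum (map (λ p → ∣ V (lower p) ∣) (suc p ∷ []))
            ≡⟨ sum-map-++ (λ p → ∣ V (lower p) ∣) [ 1 ⋯ p ] (suc p ∷ []) ⟨
          sum (map (λ p → ∣ V (lower p) ∣) ([ 1 ⋯ p ] ++ suc p ∷ []))
            ≡⟨ cong (λ ps → sum (map (λ p → ∣ V (lower p) ∣) ps)) (applyUpTo-∷ʳ suc p) ⟩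
          B (suc p) ∎))
        where
        open ≤-Reasoning
        κ : ℕ
        κ = m ∸ suc p
        B : ℕ → ℕ
        B p = ∑[ 1 ⋯ p ] (λ p → ∣ V (lower p) ∣)
        before : Fin (ℓ Π (suc p)) → ℕ
        before i = sum (map (λ X → ∣ vertices X ∣) (take (toℕ i) (lower (suc p))))
        p<m : suc p < m
        p<m = ≤-trans (≤-trans (m≤m+n (suc (suc p)) d) (≤-reflexive (sym (+-suc (suc p) d))))
          (≤-reflexive p+d≡m)
        p≤m-1 : suc p ≤ m ∸ 1
        p≤m-1 = m+n≤o⇒m≤o∸n (suc p) (≤-trans (≤-reflexive (+-comm (suc p) 1)) p<m)
        p∈ : suc p ∈ˡ [ 1 ⋯ m ∸ 1 ]
        p∈ = ∈-applyUpTo⁺ suc p≤m-1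
        rearrange : ∀ s b x → suc (s + (b + x)) ≡ s + b + x + 1
        rearrange = solve-∀

      covered₀ : ∀ v → Any (v ∈_) U₀ ⊎ Any ((v ∈_) ∘ proj₂) L₀
      covered₀ v = Sum.swap (Sum.map
        (λ v∈ → Any.concatMap⁺ block
          (Any.map (λ {p} → Any.map⁺ ∘ Any.map ∈-vertices⁺)
            (Any.concatMap⁻ lower {xs = [ 1 ⋯ m ∸ 1 ]} v∈)))
        (Any.map⁺ ∘ Any.map ∈-vertices⁺)
        (∈-++⁻ (concatMap lower [ 1 ⋯ m ∸ 1 ]) (∈-resp-↭ (↭-sym partition) (∈-allFin (partOf v)))))

      initial : Moves.Position G K U₀ L₀ ⊤ f
      initial = record
        { upperFits        = All.map⁺ (All.tabulate λ {X} X∈ → Mv.fits (vertices-independent X)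
            (≤-trans (∈-upperParts⁻ X∈) (m≤n+m∸n m 1)) (rich₀ X∈))
        ; lowerServed      = subst (λ ps → Served (spread U₀) f K 0 (concatMap block ps))
            (sym (range≡upFrom 1 (m ∸ 1)))
            (served-from (m ∸ 1) 0 (m+[n∸m]≡n 1≤m) ≤-refl z≤n)
        ; lowerIndependent = All.concat⁺ (All.map⁺ (All.universal
            (λ p → All.map⁺ (All.universal vertices-independent (lower p))) [ 1 ⋯ m ∸ 1 ]))
        ; covered          = λ {v} _ → covered₀ v
        }

theorem6 : ∀ {n} (G : Graph n) (M : CompleteMultipartite G) (m : ℕ) →
    IndependenceNumber G m → 2 ≤ m →
    (Π : Partition M m) (f : Fin n → ℕ) →
    let open CompleteMultipartite M
        open Partition Π
    in
    (∀ j → 1 ≤ j → j ≤ m → [ α Π j + β Π j ] ≤⁺ F Π f j) →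
    (∀ j → 1 ≤ j → j ≤ m ∸ 1 → (i : Fin (ℓ Π j)) →
      ∀ v → v ∈ vertices (lookup (lower j) i) →
        S Π (m ∸ j) + ∑[ 1 ⋯ j ∸ 1 ] (λ p → ∣ V (lower p) ∣)
          + sum (map (λ X → ∣ vertices X ∣) (take (toℕ i) (lower j))) + 1
        ≤ f v) →
    OnlineChoosable G f
theorem6 G M m _ 2≤m Π f R1 R2 = strategy , winning
  where open Respond.Strategies G (m ∸ 1) f (_ , _ , initial M m (<⇒≤ 2≤m) Π f R1 R2)
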